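{- Let $k,n$ be integers with $n\ge 2$ and $3\le k\le n+1$. If every plausible $\tau$-parity for $(k,n)$ is actual for $(k,n)$, then there exists $N_0$ such that for all integers $N\ge N_0$, every plausible $\tau$-parity for $(k,N)$ is actual for $(k,N)$.
   Context: An orthogonal array $\mathrm{OA}(k,n)$ on an alphabet $\Lambda$ with $|\Lambda|=n$ is an $n^2\times k$ matrix $A=(a_{r\ell})$ with entries in $\Lambda$ such that in every pair of distinct columns each ordered pair in $\Lambda^2$ occurs in exactly one row. For distinct columns $c,i,j\in\{1,\dots,k\}$ and $s\in\Lambda$, let $\rho_s(c,i,j)$ be the permutation of $\Lambda$ mapping $a_{ri}\mapsto a_{rj}$ for all rows $r$ with $a_{rc}=s$. With $\pi(\gamma)\in\mathbb{Z}_2$ denoting the parity of a permutation $\gamma$ ($0$ for even, $1$ for odd), define $\tau^c_{ij}(A)=\sum_{s\in\Lambda}\pi(\rho_s(c,i,j))\in\mathbb{Z}_2$. The $\tau$-parity of $A$ is the vector $(\tau^c_{ij}(A))$ indexed by the ordered triples $(c,i,j)$ of distinct elements of $\{1,\dots,k\}$. A plausible $\tau$-parity for $(k,n)$ is any $\mathbb{Z}_2$-vector $(\tau^c_{ij})$ indexed by the ordered triples $(c,i,j)$ of distinct elements of $\{1,\dots,k\}$ such that, in $\mathbb{Z}_2$: (1) $\tau^c_{ij}=\tau^c_{ji}$ for all distinct $c,i,j$; (2) $\tau^c_{ij}=\tau^c_{i\ell}+\tau^c_{\ell j}$ for all distinct $c,i,j,\ell$; (3) $\tau^c_{ij}+\tau^i_{cj}+\tau^j_{ci}=\binom{n}{2}$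 for all distinct $c,i,j$. It is actual for $(k,n)$ if it is the $\tau$-parity of some $\mathrm{OA}(k,n)$. -}

module Defs where

open import Data.Bool.Base using (if_then_else_)
open import Data.Fin.Base using (Fin)
open import Data.Fin.Permutation using (Permutation′; permutation; _⟨$⟩ʳ_)
open import Data.Fin.Properties using (_<?_)
open import Data.Nat.Base using (ℕ; _*_; parity)
open import Data.Nat.Combinatorics using (_C_)
open import Data.Parity.Base using (Parity; 0ℙ; 1ℙ; _+_)
open import Data.Parity.Properties using (+-0-monoid)
open import Data.Product using (_×_; _,_; ∃; ∃!; proj₁; proj₂)
open import Relation.Binary.PropositionalEquality
  using (_≡_; _≢_; refl; trans; cong)
open import Relation.Nullary using (does)
open import Relation.Nullary.Decidable using (_×-dec_)

open import Algebra.Properties.Monoid.Sum +-0-monoid using (sum-syntax)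

private
  variable
    k n : ℕ

-- ℤ₂ is the library's Parity.  The parity of a permutation is the number of
-- its inversions (pairs x < y with γ y < γ x), modulo 2.
π : Permutation′ n → Parity
π {n} γ =
  ∑[ x < n ] ∑[ y < n ]
    (if does ((x <? y) ×-dec ((γ ⟨$⟩ʳ y) <? (γ ⟨$⟩ʳ x))) then 1ℙ else 0ℙ)

-- The alphabet Λ is Fin n; rows are indexed by Fin (n * n).
record OA (k n : ℕ) : Set where
  field
    entry  : Fin (n * n) → Fin k → Fin n
    unique : ∀ {i j} → i ≢ j → ∀ x y →
             ∃! _≡_ λ r → entry r i ≡ x × entry r j ≡ y

Distinct : (c i j : Fin k) → Set
Distinct c i j = c ≢ i × c ≢ j × i ≢ j

module _ (A : OA k n) where
  open OA A

  private
    row : ∀ {i j} → i ≢ j → Fin n → Fin n → Fin (n * n)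
    row i≢j x y = proj₁ (unique i≢j x y)

    -- The j-entry of the unique row whose c-entry is s and whose i-entry is x.
    image : ∀ {c i} → c ≢ i → (j : Fin k) (s x : Fin n) → Fin n
    image c≢i j s x = entry (row c≢i s x) j

    image-entry : ∀ {c i} (c≢i : c ≢ i) j {s} r → entry r c ≡ s →
                  image c≢i j s (entry r i) ≡ entry r j
    image-entry {i = i} c≢i j {s} r rc≡s =
      cong (λ r′ → entry r′ j)
        (proj₂ (proj₂ (unique c≢i s (entry r i))) (rc≡s , refl))

    image-inverse : ∀ {c i j} (c≢i : c ≢ i) (c≢j : c ≢ j) s x →
                    image c≢i j s (image c≢j i s x) ≡ x
    image-inverse {j = j} c≢i c≢j s x
      with r , (rc≡s , rj≡x) , _ ← unique c≢j s x =
      trans (image-entry c≢i j r rc≡s) rj≡x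

  ρ : (s : Fin n) (c i j : Fin k) → Distinct c i j → Permutation′ n
  ρ s c i j (c≢i , c≢j , _) = permutation
    (image c≢i j s)
    (image c≢j i s)
    (image-inverse c≢i c≢j s)
    (image-inverse c≢j c≢i s)

  ρ-entry : ∀ s c i j (d : Distinct c i j) r → entry r c ≡ s →
            ρ s c i j d ⟨$⟩ʳ entry r i ≡ entry r j
  ρ-entry s c i j (c≢i , _) = image-entry c≢i j

-- Proofs of Distinct c i j are definitionally equal (⊥ is proof-irrelevant), so
-- this is a family indexed by ordered triples of distinct columns.
TripleVector : ℕ → Set
TripleVector k = (c i j : Fin k) → Distinct c i j → Parity

τ : OA k n → TripleVector k
τ {n = n} A c i j d = ∑[ s < n ] π (ρ A s c i j d)

record Plausible (k n : ℕ) (t : TripleVector k) : Set where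
  field
    symmetric : ∀ {c i j} (cij : Distinct c i j) (cji : Distinct c j i) →
                t c i j cij ≡ t c j i cji
    -- Together the three hypotheses say that c, i, j, ℓ are distinct.
    additive  : ∀ {c i j ℓ} (cij : Distinct c i j)
                (ciℓ : Distinct c i ℓ) (cℓj : Distinct c ℓ j) →
                t c i j cij ≡ t c i ℓ ciℓ + t c ℓ j cℓj
    cyclic    : ∀ {c i j} (cij : Distinct c i j)
                (icj : Distinct i c j) (jci : Distinct j c i) →
                t c i j cij + t i c j icj + t j c i jci ≡ parity (n C 2)

Actual : (k n : ℕ) → TripleVector k → Set
Actual k n t = ∃ λ (A : OA k n) → ∀ c i j d → τ A c i j d ≡ t c i j d

{-# OPTIONS --safe #-}
-- Every τ-parity is plausible. For the cyclic relation, follow the pair of entries of a row through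
-- the pairs of columns ci, cj, jc, ji, ij, ic, ci: this is a loop of permutations of the n² pairs of
-- symbols, of signs τ^c_ij, C(n,2), τ^j_ci, C(n,2), τ^i_jc, C(n,2).
-- If an OA(k,N) contains an OA(k,n) on its first n symbols, exchanging the latter for another OA(k,n)
-- changes both τ-parities by the same vector. Given t plausible for (k,N), the vector by which the
-- τ-parity of the large array must change to become t turns the τ-parity of the small array into a
-- vector plausible, hence actual, for (k,n).
--
-- It remains to embed a given OA(k,n) in an OA(k,N) for all large N. Wilson's construction makes an
-- array of order mt + u from arrays of orders m, m+1, u ≤ t and one of order t with an extra column.
-- Instead of finite fields it can be fed with arrays of order q^D for all q, where D depends on k only,
-- and of order q for q without small prime factors; this gives arrays of all large orders
-- (Chowla–Erdős–Straus). Another use of the construction then leaves a hole of order a multiple of n,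
-- to be filled by a product containing the OA(k,n).
module Submission where

open import Defs
open import Data.Bool.Base using (true; false; _∧_; if_then_else_)
open import Data.Empty using (⊥)
open import Data.Fin.Base
  using (Fin; zero; suc; toℕ; fromℕ; inject₁; combine; remQuot; finToFun; funToFin; splitAt; join; _↑ˡ_; _↑ʳ_)
  renaming (_<_ to _<ᶠ_)
open import Data.Fin.Induction using (<-weakInduction; >-weakInduction)
open import Data.Fin.Permutation
  using (Permutation′; permutation; transpose; _⟨$⟩ʳ_; _⟨$⟩ˡ_; _∘ₚ_; inverseˡ; inverseʳ)
open import Data.Fin.Properties
  using (suc-injective; toℕ<n; toℕ-injective; toℕ-fromℕ<; any?; pigeonhole; _<?_; <⇒≢; <-cmp; +↔⊎; *↔×;
         finToFun-funToFin; funToFin-finToFin; punchInᵢ≢i; toℕ-↑ˡ; toℕ-↑ʳ; splitAt-↑ʳ; splitAt⁻¹-↑ˡ; splitAt⁻¹-↑ʳ;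
         join-splitAt; toℕ-combine; combine-injective; combine-monoˡ-<; combine-remQuot; remQuot-combine)
  renaming (_≟_ to _≟ᶠ_; <-irrefl to <ᶠ-irrefl; <-asym to <ᶠ-asym)
open import Data.List.Base using ([]; _∷_)
open import Data.Nat.Base
open import Data.Nat.Combinatorics using (_C_; nCk+nC[k+1]≡[n+1]C[k+1]; nC1≡n)
open import Data.Nat.Coprimality using (Coprime; coprime-divisor)
open import Data.Nat.Divisibility
open import Data.Nat.DivMod
open import Data.Nat.Primality
  using (Prime; prime?; prime[2]; ¬prime[0]; ¬prime[1]; prime⇒nonTrivial; prime⇒irreducible; euclidsLemma;
         _Rough_; 0-rough; 1-rough; 2-rough; ∤⇒rough-suc; rough∧∣⇒prime)
open import Data.Nat.Properties hiding (_≟_; _<?_; <⇒≢; <-cmp; suc-injective)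
open import Data.Nat.Tactic.RingSolver using (solve)
open import Data.Parity.Base using (Parity; 0ℙ; 1ℙ) renaming (_⁻¹ to _⁻¹ℙ)
import Data.Parity.Base as ℙ
import Data.Parity.Properties as ℙ
open import Data.Product using (_×_; _,_; ∃; proj₁; proj₂; uncurry)
open import Data.Product.Function.NonDependent.Propositional using (_×-↔_)
open import Data.Sum using (_⊎_; inj₁; inj₂; [_,_]′)
open import Data.Sum.Algebra using (⊎-assoc)
open import Data.Sum.Function.Propositional using (_⊎-↔_)
open import Data.Sum.Properties using (inj₁-injective; inj₂-injective)
open import Data.Unit using (⊤; tt)
open import Function using (_∘_; _↔_; Inverse; mk↔ₛ′)
open import Function.Construct.Composition using (_↔-∘_)
open import Function.Construct.Identity using (↔-id)
open import Function.Construct.Symmetry using (↔-sym)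
open import Level using (0ℓ)
open import Relation.Binary.Definitions using (tri<; tri≈; tri>)
open import Relation.Binary.PropositionalEquality
open import Relation.Nullary using (¬_; Dec; yes; no; does; contradiction)
open import Relation.Nullary.Decidable using (dec-true; dec-false)
open import Algebra.Properties.CommutativeMonoid.Sum ℙ.+-0-commutativeMonoid
  using (sum; sum-syntax; sum-cong-≗; sum-remove; sum-replicate-zero; ∑-distrib-+; ∑-comm; ∑-permute)
open import Algebra.Properties.Semiring.Sum ℙ.+-*-semiring using (*-distribˡ-sum; *-distribʳ-sum)
open import Algebra.Solver.CommutativeMonoid ℙ.+-0-commutativeMonoid
  using (_⊕_; _⊜_) renaming (solve to solve⊕)

-- Orthogonal arrays with a hole

-- An orthogonal array with a hole P: pairs of symbols of the hole occur in no row.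
record Holey (k : ℕ) (X : Set) (P : X → Set) : Set₁ where
  field
    Row       : Set
    entry     : Row → Fin k → X
    injective : ∀ {i j r r′} → i ≢ j → entry r i ≡ entry r′ i → entry r j ≡ entry r′ j → r ≡ r′
    exists    : ∀ {i j} → i ≢ j → ∀ x y → ¬ (P x × P y) → ∃ λ r → entry r i ≡ x × entry r j ≡ y
    sparse    : ∀ {i j r} → i ≢ j → P (entry r i) → ¬ P (entry r j)

Array : ℕ → Set → Set₁
Array k X = Holey k X (λ _ → ⊥)

Left : {H Y : Set} → H ⊎ Y → Set
Left (inj₁ _) = ⊤
Left (inj₂ _) = ⊥

OnLeft : {H Y : Set} → (H → Set) → H ⊎ Y → Set
OnLeft Q (inj₁ h) = Q h
OnLeft Q (inj₂ _) = ⊥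

module _ {k : ℕ} {X Y : Set} {P : X → Set} {Q : Y → Set} where

  -- The bijection may vary with the column: apart from membership in the hole, entries of different
  -- columns are never compared.
  relabel : (f : Fin k → X ↔ Y) →
            (∀ i {x} → P x → Q (Inverse.to (f i) x)) →
            (∀ i {x} → Q (Inverse.to (f i) x) → P x) →
            Holey k X P → Holey k Y Q
  relabel f P⇒Q Q⇒P A = record
    { Row       = Row
    ; entry     = λ r i → to i (entry r i)
    ; injective = λ i≢j p q → injective i≢j (to-injective _ p) (to-injective _ q)
    ; exists    = λ {i} {j} i≢j x y ¬QQ →
        let r , p , q = exists i≢j (from i x) (from j y) λ (Px , Py) →
              ¬QQ ( subst Q (Inverse.strictlyInverseˡ (f i) x) (P⇒Q i Px)
                  , subst Q (Inverse.strictlyInverseˡ (f j) y) (P⇒Q j Py))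
        in r , trans (cong (to i) p) (Inverse.strictlyInverseˡ (f i) x)
             , trans (cong (to j) q) (Inverse.strictlyInverseˡ (f j) y)
    ; sparse    = λ {i} {j} i≢j Qx Qy → sparse i≢j (Q⇒P i Qx) (Q⇒P j Qy)
    }
    where
    open Holey A
    to : Fin k → X → Y
    to i = Inverse.to (f i)
    from : Fin k → Y → X
    from i = Inverse.from (f i)
    to-injective : ∀ i {x y} → to i x ≡ to i y → x ≡ y
    to-injective i {x} {y} eq = trans (sym (Inverse.strictlyInverseʳ (f i) x))
      (trans (cong (from i) eq) (Inverse.strictlyInverseʳ (f i) y))

relabelArray : ∀ {k X Y} → X ↔ Y → Array k X → Array k Y
relabelArray f = relabel (λ _ → f) (λ _ ()) (λ _ ())

dropColumn : ∀ {k X P} → Holey (suc k) X P → Holey k X P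
dropColumn A = record
  { Row       = Row
  ; entry     = λ r i → entry r (suc i)
  ; injective = λ i≢j → injective (i≢j ∘ suc-injective)
  ; exists    = λ i≢j → exists (i≢j ∘ suc-injective)
  ; sparse    = λ i≢j → sparse (i≢j ∘ suc-injective)
  }
  where open Holey A

_⊗_ : ∀ {k X Y P} → Holey k X P → Array k Y → Holey k (X × Y) (P ∘ proj₁)
A ⊗ B = record
  { Row       = A.Row × B.Row
  ; entry     = λ (r , s) i → A.entry r i , B.entry s i
  ; injective = λ i≢j p q → cong₂ _,_ (A.injective i≢j (cong proj₁ p) (cong proj₁ q))
                                      (B.injective i≢j (cong proj₂ p) (cong proj₂ q))
  ; exists    = λ i≢j (x , y) (x′ , y′) ¬PP →
      let r , p , q = A.exists i≢j x x′ ¬PP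
          s , p′ , q′ = B.exists i≢j y y′ proj₁
      in (r , s) , cong₂ _,_ p p′ , cong₂ _,_ q q′
  ; sparse    = A.sparse
  }
  where
  module A = Holey A
  module B = Holey B

_⊗ᶠ_ : ∀ {k m n} → Array k (Fin m) → Array k (Fin n) → Array k (Fin (m * n))
_⊗ᶠ_ {k} {m} {n} A B = relabelArray (↔-sym (*↔× {m} {n})) (A ⊗ B)

-- Pairs of hole symbols are left to `B`, all others to `A`. A row of `A` and a row of `B` cannot
-- agree in two columns, because a row of `A` has at most one hole symbol.
fill : ∀ {k H Y} {Q : H → Set} → Holey k (H ⊎ Y) Left → Holey k H Q → Holey k (H ⊎ Y) (OnLeft Q)
fill {k} {H} {Y} {Q} A B = record
  { Row       = A.Row ⊎ B.Row
  ; entry     = entry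
  ; injective = inj
  ; exists    = ex
  ; sparse    = λ {i} {j} {r} → sp {i} {j} {r}
  }
  where
  module A = Holey A
  module B = Holey B
  entry : A.Row ⊎ B.Row → Fin k → H ⊎ Y
  entry (inj₁ r) = A.entry r
  entry (inj₂ r) = inj₁ ∘ B.entry r
  left : ∀ {h} {x : H ⊎ Y} → x ≡ inj₁ h → Left x
  left refl = tt
  OnLeft⇒Left : ∀ {x : H ⊎ Y} → OnLeft Q x → Left x
  OnLeft⇒Left {inj₁ _} _ = tt
  inj : ∀ {i j r r′} → i ≢ j → entry r i ≡ entry r′ i → entry r j ≡ entry r′ j → r ≡ r′
  inj {r = inj₁ _} {inj₁ _} i≢j p q = cong inj₁ (A.injective i≢j p q)
  inj {r = inj₁ _} {inj₂ _} i≢j p q = contradiction (left q) (A.sparse i≢j (left p))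
  inj {r = inj₂ _} {inj₁ _} i≢j p q = contradiction (left (sym q)) (A.sparse i≢j (left (sym p)))
  inj {r = inj₂ _} {inj₂ _} i≢j p q =
    cong inj₂ (B.injective i≢j (inj₁-injective p) (inj₁-injective q))
  ex : ∀ {i j} → i ≢ j → ∀ x y → ¬ (OnLeft Q x × OnLeft Q y) → ∃ λ r → entry r i ≡ x × entry r j ≡ y
  ex i≢j (inj₁ h) (inj₁ h′) ¬QQ with r , p , q ← B.exists i≢j h h′ ¬QQ =
    inj₂ r , cong inj₁ p , cong inj₁ q
  ex i≢j x@(inj₁ _) y@(inj₂ _) _ with r , p , q ← A.exists i≢j x y proj₂ = inj₁ r , p , q
  ex i≢j x@(inj₂ _) y@(inj₁ _) _ with r , p , q ← A.exists i≢j x y proj₁ = inj₁ r , p , q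
  ex i≢j x@(inj₂ _) y@(inj₂ _) _ with r , p , q ← A.exists i≢j x y proj₁ = inj₁ r , p , q
  sp : ∀ {i j r} → i ≢ j → OnLeft Q (entry r i) → ¬ OnLeft Q (entry r j)
  sp {r = inj₁ r} i≢j Qx Qy = A.sparse i≢j (OnLeft⇒Left Qx) (OnLeft⇒Left Qy)
  sp {r = inj₂ r} = B.sparse

fillArray : ∀ {k H Y} → Holey k (H ⊎ Y) Left → Array k H → Array k (H ⊎ Y)
fillArray A B = relabel (λ _ → ↔-id _) (λ { _ {inj₁ _} () ; _ {inj₂ _} () }) (λ _ ()) (fill A B)

-- In any two columns the deleted row is the only one carrying `x₀` twice, so its loss creates
-- exactly this one-point hole.
removeRow : ∀ {k X} (A : Array k X) (r₀ : Holey.Row A) {x₀} → (∀ i → Holey.entry A r₀ i ≡ x₀) →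
            Holey k X (_≡ x₀)
removeRow A r₀ constant = record
  { Row       = ∃ (_≢ r₀)
  ; entry     = entry ∘ proj₁
  ; injective = λ i≢j p q → lift (injective i≢j p q)
  ; exists    = λ i≢j x y ¬PP →
      let r , p , q = exists i≢j x y proj₁
      in (r , λ r≡r₀ → ¬PP ( trans (sym p) (trans (cong (λ r′ → entry r′ _) r≡r₀) (constant _))
                           , trans (sym q) (trans (cong (λ r′ → entry r′ _) r≡r₀) (constant _))))
         , p , q
  ; sparse    = λ { {r = _ , r≢r₀} i≢j p q →
      r≢r₀ (injective i≢j (trans p (sym (constant _))) (trans q (sym (constant _)))) }
  }
  where
  open Holey A
  lift : ∀ {r r′ : ∃ (_≢ r₀)} → proj₁ r ≡ proj₁ r′ → r ≡ r′
  lift refl = refl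

-- Any row becomes constant after a suitable transposition of symbols in each column; then it is
-- deleted.
puncture : ∀ {k m} → Array (2 + k) (Fin (suc m)) → Holey (2 + k) (Fin (suc m)) (_≡ zero)
puncture {k} {m} A = removeRow (relabel (λ i → transpose (entry r₀ i) zero) (λ _ ()) (λ _ ()) A)
  r₀ (λ i → transpose-first (entry r₀ i) zero)
  where
  open Holey A
  r₀ : Row
  r₀ = proj₁ (exists {zero} {suc zero} (λ ()) zero zero proj₁)
  transpose-first : ∀ {n} (i j : Fin n) → Inverse.to (transpose i j) i ≡ j
  transpose-first i j rewrite dec-true (i ≟ᶠ i) refl = refl

-- The construction behind N(mt + u) ≥ min(N(m), N(m+1), N(t) − 1, N(u)) (Bose–Shrikhande–Parker,
-- Wilson): each row of T, as a block, is inflated by A or by B according to its symbol in the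
-- extra column; the infinite point of a copy of B is identified with that symbol.
module Wilson {k m : ℕ} {U W : Set} (T : Array (suc k) (U ⊎ W))
              (A : Array k (Fin m)) (B : Holey k (Fin (suc m)) (_≡ zero)) where
  private
    module T = Holey T
    module A = Holey A
    module B = Holey B

  Symbol : Set
  Symbol = U ⊎ ((U ⊎ W) × Fin m)

  Filling : U ⊎ W → Set
  Filling (inj₁ _) = B.Row
  Filling (inj₂ _) = A.Row

  glue : U → U ⊎ W → Fin (suc m) → Symbol
  glue s q zero    = inj₁ s
  glue s q (suc a) = inj₂ (q , a)

  cell : ∀ c → Filling c → U ⊎ W → Fin k → Symbol
  cell (inj₁ s) f q i = glue s q (B.entry f i)
  cell (inj₂ _) f q i = inj₂ (q , A.entry f i)

  Row : Set
  Row = ∃ λ b → Filling (T.entry b zero)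

  entry : Row → Fin k → Symbol
  entry (b , f) i = cell (T.entry b zero) f (T.entry b (suc i)) i

  glue-left : ∀ {s q} a → Left (glue s q a) → a ≡ zero
  glue-left zero _ = refl

  glue-injective : ∀ {s q} a a′ → glue s q a ≡ glue s q a′ → a ≡ a′
  glue-injective zero    zero    _    = refl
  glue-injective (suc a) (suc _) refl = refl

  cell-sparse : ∀ {i j} c f {q q′} → i ≢ j → Left (cell c f q i) → ¬ Left (cell c f q′ j)
  cell-sparse (inj₁ s) f i≢j p p′ = B.sparse i≢j (glue-left _ p) (glue-left _ p′)

  cell-injective : ∀ {i j} c {f f′} {q q′} → i ≢ j →
                   cell c f q i ≡ cell c f′ q i → cell c f q′ j ≡ cell c f′ q′ j → f ≡ f′
  cell-injective (inj₁ s) i≢j p p′ =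
    B.injective i≢j (glue-injective _ _ p) (glue-injective _ _ p′)
  cell-injective (inj₂ _) i≢j p p′ =
    A.injective i≢j (cong proj₂ (inj₂-injective p)) (cong proj₂ (inj₂-injective p′))

  -- A finite point reveals its symbol of `T`; an infinite point reveals the symbol in the extra
  -- column.
  cell-block : ∀ c c′ f f′ {q q′ i} → cell c f q i ≡ cell c′ f′ q′ i →
               q ≡ q′ ⊎ (c ≡ c′ × Left (cell c f q i))
  cell-block (inj₁ s) (inj₁ s′) f f′ {i = i} eq with B.entry f i | B.entry f′ i
  cell-block (inj₁ s) (inj₁ s′) f f′ refl | zero | zero  = inj₂ (refl , tt)
  cell-block (inj₁ s) (inj₁ s′) f f′ refl | suc _ | suc _ = inj₁ refl
  cell-block (inj₁ s) (inj₂ _)  f f′ {i = i} eq with B.entry f i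
  cell-block (inj₁ s) (inj₂ _)  f f′ refl | suc _ = inj₁ refl
  cell-block (inj₂ _) (inj₁ s)  f f′ {i = i} eq with B.entry f′ i
  cell-block (inj₂ _) (inj₁ s)  f f′ refl | suc _ = inj₁ refl
  cell-block (inj₂ _) (inj₂ _)  f f′ eq = inj₁ (cong proj₁ (inj₂-injective eq))

  suc-≢ : ∀ {i j : Fin k} → i ≢ j → suc i ≢ suc j
  suc-≢ i≢j = i≢j ∘ suc-injective

  injective : ∀ {i j r r′} → i ≢ j → entry r i ≡ entry r′ i → entry r j ≡ entry r′ j → r ≡ r′
  -- Two agreements give two columns of `T`, possibly the extra one, that determine the block. Only
  -- two agreements at infinite points would fail to, and `cell-sparse` excludes them.
  injective {i} {j} {b , f} {b′ , f′} i≢j p p′ with same-block (cell-block _ _ f f′ p) (cell-block _ _ f f′ p′)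
    where
    same-block : T.entry b (suc i) ≡ T.entry b′ (suc i) ⊎ _ → T.entry b (suc j) ≡ T.entry b′ (suc j) ⊎ _ → b ≡ b′
    same-block (inj₁ q)       (inj₁ q′)       = T.injective (suc-≢ i≢j) q q′
    same-block (inj₁ q)       (inj₂ (c , _))  = T.injective (λ ()) q c
    same-block (inj₂ (c , _)) (inj₁ q′)       = T.injective (λ ()) c q′
    same-block (inj₂ (_ , l)) (inj₂ (_ , l′)) = contradiction l′ (cell-sparse (T.entry b zero) f i≢j l)
  ... | refl = cong (b ,_) (cell-injective (T.entry b zero) i≢j p p′)

  cell-exists : ∀ {i j} c q q′ a a′ → i ≢ j →
                ∃ λ f → cell c f q i ≡ inj₂ (q , a) × cell c f q′ j ≡ inj₂ (q′ , a′)
  cell-exists (inj₁ s) q q′ a a′ i≢j with f , p , p′ ← B.exists i≢j (suc a) (suc a′) (λ ()) =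
    f , cong (glue s q) p , cong (glue s q′) p′
  cell-exists (inj₂ _) q q′ a a′ i≢j with f , p , p′ ← A.exists i≢j a a′ proj₁ =
    f , cong (λ x → inj₂ (q , x)) p , cong (λ x → inj₂ (q′ , x)) p′

  cell-exists-left : ∀ {i j} {c s} → c ≡ inj₁ s → ∀ q q′ a → i ≢ j →
                     ∃ λ f → cell c f q i ≡ inj₂ (q , a) × cell c f q′ j ≡ inj₁ s
  cell-exists-left {s = s} refl q q′ a i≢j with f , p , p′ ← B.exists i≢j (suc a) zero (λ ()) =
    f , cong (glue s q) p , cong (glue s q′) p′

  exists-left : ∀ {i j} → i ≢ j → ∀ q a s → ∃ λ r → entry r i ≡ inj₂ (q , a) × entry r j ≡ inj₁ s
  exists-left {i} {j} i≢j q a s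
    -- The infinite point `s` occurs only in blocks with `s` in the extra column, so this column and
    -- column `i` select the block.
    with b , refl , z ← T.exists {suc i} {zero} (λ ()) q (inj₁ s) proj₁
    with f , p , p′ ← cell-exists-left z (T.entry b (suc i)) (T.entry b (suc j)) a i≢j =
    (b , f) , p , p′

  exists : ∀ {i j} → i ≢ j → ∀ x y → ¬ (Left x × Left y) → ∃ λ r → entry r i ≡ x × entry r j ≡ y
  exists i≢j (inj₁ _) (inj₁ _) ¬LL = contradiction (tt , tt) ¬LL
  exists i≢j (inj₁ s) (inj₂ (q , a)) _ with r , p , p′ ← exists-left (≢-sym i≢j) q a s = r , p′ , p
  exists i≢j (inj₂ (q , a)) (inj₁ s) _ = exists-left i≢j q a s
  exists i≢j (inj₂ (q , a)) (inj₂ (q′ , a′)) _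
    with b , refl , refl ← T.exists (suc-≢ i≢j) q q′ proj₁
    with f , p , p′ ← cell-exists (T.entry b zero) _ _ a a′ i≢j = (b , f) , p , p′

  wilson : Holey k Symbol Left
  wilson = record
    { Row       = Row
    ; entry     = entry
    ; injective = injective
    ; exists    = exists
    ; sparse    = λ { {r = b , f} i≢j → cell-sparse (T.entry b zero) f i≢j }
    }

open Wilson using (wilson) public

-- Arrays from counting, and lines over ℤ/q

injective⇒surjective : ∀ {n} (f : Fin n → Fin n) → (∀ {x y} → f x ≡ f y → x ≡ y) →
                       ∀ y → ∃ λ x → f x ≡ y
injective⇒surjective {n} f f-injective y with any? (λ x → f x ≟ᶠ y)
... | yes found = found
-- A missed `y` together with the n values of `f` would be n + 1 distinct elements of `Fin n`.
... | no missed with pigeonhole (n<1+n n) (λ { zero → y ; (suc x) → f x })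
...   | zero  , suc x  , _   , eq = contradiction (x , sym eq) missed
...   | suc x , suc x′ , x<x′ , eq = contradiction (cong suc (f-injective eq)) (<⇒≢ x<x′)

-- With exactly n² rows, sending a row to its entries in two columns is an injection between sets of
-- equal size, hence onto.
arrayFromInjective : ∀ {k n} (entry : Fin n × Fin n → Fin k → Fin n) →
  (∀ {i j r r′} → i ≢ j → entry r i ≡ entry r′ i → entry r j ≡ entry r′ j → r ≡ r′) → Array k (Fin n)
arrayFromInjective {k} {n} entry injective = record
  { Row       = Fin n × Fin n
  ; entry     = entry
  ; injective = injective
  ; exists    = λ {i} {j} i≢j x y _ →
      let c , eq = injective⇒surjective (λ c → combine (entry (remQuot n c) i) (entry (remQuot n c) j))
                     (λ eq → let p , q = combine-injective _ _ _ _ eq in remQuot-injective (injective i≢j p q))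
                     (combine x y)
      in remQuot n c , combine-injective _ _ _ _ eq
  ; sparse    = λ _ ()
  }
  where
  remQuot-injective : ∀ {c c′ : Fin (n * n)} → remQuot n c ≡ remQuot n c′ → c ≡ c′
  remQuot-injective {c} {c′} eq =
    trans (sym (combine-remQuot {n} n c)) (trans (cong (uncurry combine) eq) (combine-remQuot {n} n c′))

module _ (q : ℕ) .{{_ : NonZero q}} where

  ≡%⇒∣∣-∣ : ∀ {a b} → a % q ≡ b % q → q ∣ ∣ a - b ∣
  ≡%⇒∣∣-∣ {a} {b} eq = divides ∣ a / q - b / q ∣ (begin
    ∣ a - b ∣                                         ≡⟨ cong₂ ∣_-_∣ (m≡m%n+[m/n]*n a q) (m≡m%n+[m/n]*n b q) ⟩
    ∣ a % q + a / q * q - b % q + b / q * q ∣         ≡⟨ cong (λ r → ∣ r + a / q * q - b % q + b / q * q ∣) eq ⟩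
    ∣ b % q + a / q * q - b % q + b / q * q ∣         ≡⟨ ∣m+n-m+o∣≡∣n-o∣ (b % q) _ _ ⟩
    ∣ a / q * q - b / q * q ∣                         ≡⟨ *-distribʳ-∣-∣ q (a / q) (b / q) ⟨
    ∣ a / q - b / q ∣ * q                             ∎)
    where open ≡-Reasoning

  %-cancelˡ : ∀ {a a′ c c′} → a % q ≡ a′ % q → (a + c) % q ≡ (a′ + c′) % q → q ∣ ∣ c - c′ ∣
  %-cancelˡ {a} {a′} {c} {c′} p p′ = subst (q ∣_) (∣m+n-m+o∣≡∣n-o∣ (a % q) c c′) (≡%⇒∣∣-∣ (begin
    (a % q + c) % q      ≡⟨ reduce a c ⟩
    (a + c) % q          ≡⟨ p′ ⟩
    (a′ + c′) % q        ≡⟨ reduce a′ c′ ⟨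
    (a′ % q + c′) % q    ≡⟨ cong (λ r → (r + c′) % q) p ⟨
    (a % q + c′) % q     ∎))
    where
    open ≡-Reasoning
    reduce : ∀ x y → (x % q + y) % q ≡ (x + y) % q
    reduce x y = trans (%-distribˡ-+ (x % q) y q)
      (trans (cong (λ r → (r + y % q) % q) (m%n%n≡m%n x q)) (sym (%-distribˡ-+ x y q)))

  ∣-∣-small : (x y : Fin q) → q ∣ ∣ toℕ x - toℕ y ∣ → x ≡ y
  ∣-∣-small x y q∣ with ∣ toℕ x - toℕ y ∣ in eq
  ... | zero  = toℕ-injective (∣m-n∣≡0⇒m≡n eq)
  ... | suc d = contradiction (∣⇒≤ q∣) (<⇒≱ (subst (_< q) eq
                  (≤-<-trans (∣m-n∣≤m⊔n (toℕ x) (toℕ y)) (⊔-lub (toℕ<n x) (toℕ<n y)))))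

  toℕ-mod : ∀ a → toℕ (a mod q) ≡ a % q
  toℕ-mod a = toℕ-fromℕ< (m%n<n a q)

  -- A common divisor greater than 1 is at most `d`, so it would be a divisor of `q` below `k`.
  rough⇒coprime : ∀ {k d} → k Rough q → d < k → d ≢ 0 → Coprime q d
  rough⇒coprime rough d<k d≢0 {zero}  (_ , 0∣d)       = contradiction (0∣⇒≡0 0∣d) d≢0
  rough⇒coprime rough d<k d≢0 {1}     _               = refl
  rough⇒coprime rough d<k d≢0 {2+ e}  (e∣q , e∣d)     =
    contradiction (hasNonTrivialDivisor (≤-<-trans (∣⇒≤ {{≢-nonZero d≢0}} e∣d) d<k) e∣q) rough

-- The columns y and x + i y (i < k) over ℤ/q; differences of slopes are units since q is rough.
cyclic : ∀ k q .{{_ : NonZero q}} → k Rough q → Array (suc k) (Fin q)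
cyclic k q rough = arrayFromInjective entry inj
  where
  line : ℕ → Fin q × Fin q → ℕ
  line i (x , y) = toℕ x + i * toℕ y

  entry : Fin q × Fin q → Fin (suc k) → Fin q
  entry (x , y) zero    = y
  entry r       (suc i) = line (toℕ i) r mod q

  mod⇒% : ∀ {a b} → a mod q ≡ b mod q → a % q ≡ b % q
  mod⇒% {a} {b} eq = trans (sym (toℕ-mod q a)) (trans (cong toℕ eq) (toℕ-mod q b))

  vertical : ∀ i {x x′ y} → line i (x , y) % q ≡ line i (x′ , y) % q → x ≡ x′
  vertical i {x} {x′} {y} eq = ∣-∣-small q x x′ (%-cancelˡ q {i * toℕ y} refl
    (subst₂ (λ a b → a % q ≡ b % q) (+-comm (toℕ x) _) (+-comm (toℕ x′) _) eq))

  slopes : ∀ {i j r r′} → i < j → j < k → line i r % q ≡ line i r′ % q → line j r % q ≡ line j r′ % q →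
           r ≡ r′
  slopes {i} {j} {r@(x , y)} {r′@(x′ , y′)} i<j j<k p p′ with y≡y′
    where
    d : ℕ
    d = j ∸ i
    split : ∀ s → line j s ≡ line i s + d * toℕ (proj₂ s)
    split (u , v) = trans (cong (λ l → toℕ u + l * toℕ v) (sym (m+[n∸m]≡n (<⇒≤ i<j))))
      (trans (cong (toℕ u +_) (*-distribʳ-+ (toℕ v) i d)) (sym (+-assoc (toℕ u) _ _)))
    y≡y′ : y ≡ y′
    y≡y′ = ∣-∣-small q y y′ (coprime-divisor
      (rough⇒coprime q rough (≤-<-trans (m∸n≤m j i) j<k) (m>n⇒m∸n≢0 i<j))
      (subst (q ∣_) (sym (*-distribˡ-∣-∣ d (toℕ y) (toℕ y′)))
        (%-cancelˡ q p (subst₂ (λ a b → a % q ≡ b % q) (split r) (split r′) p′))))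
  ... | refl = cong (_, y) (vertical i p)

  inj : ∀ {i j r r′} → i ≢ j → entry r i ≡ entry r′ i → entry r j ≡ entry r′ j → r ≡ r′
  inj {zero}  {zero}  i≢j _ _ = contradiction refl i≢j
  inj {zero}  {suc j} {_ , y} _ refl p = cong (_, y) (vertical (toℕ j) (mod⇒% p))
  inj {suc i} {zero}  {_ , y} _ p refl = cong (_, y) (vertical (toℕ i) (mod⇒% p))
  inj {suc i} {suc j} i≢j p p′ with <-cmp i j
  ... | tri< i<j _ _ = slopes i<j (toℕ<n j) (mod⇒% p) (mod⇒% p′)
  ... | tri≈ _ i≡j _ = contradiction (cong suc i≡j) i≢j
  ... | tri> _ _ j<i = slopes j<i (toℕ<n i) (mod⇒% p′) (mod⇒% p)

-- Adding columns by passing to powers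

prev : ∀ {n} → Fin (suc n) → Fin (suc n)
prev zero    = fromℕ _
prev (suc i) = inject₁ i

-- From `i` the property descends to `zero`, jumps to the last index and descends from there through
-- all indices.
prev-induction : ∀ {n} (P : Fin (suc n) → Set) → (∀ i → P i → P (prev i)) → ∀ {i} → P i → ∀ j → P j
prev-induction P step {i} Pi = >-weakInduction P (step zero (descend i Pi)) (step ∘ suc)
  where
  descend : ∀ i → P i → P zero
  descend = <-weakInduction (λ i → P i → P zero) (λ p → p) (λ i IH → IH ∘ step (suc i))

-- Adds a column to the k-th power of an array with columns 0, 1, …, k: the coordinate t of the new
-- column combines the column 1+t at coordinate t with the column 0 at the cyclically preceding
-- coordinate. Agreement in the new column and in column 1+t thus forces agreement in column 0 at the
-- predecessor of t, and from there on around the cycle.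
module Power {k q : ℕ} (A : Array (3 + k) (Fin q)) where
  private
    module A = Holey A
    K = 2 + k

  meet : ∀ x y → ∃ λ r → A.entry r zero ≡ x × A.entry r (suc zero) ≡ y
  meet x y = A.exists {zero} {suc zero} (λ ()) x y proj₁

  meet₀ : ∀ x y → A.entry (proj₁ (meet x y)) zero ≡ x
  meet₀ x y = proj₁ (proj₂ (meet x y))

  meet₁ : ∀ x y → A.entry (proj₁ (meet x y)) (suc zero) ≡ y
  meet₁ x y = proj₂ (proj₂ (meet x y))

  -- The quasigroup whose multiplication table is formed by columns 0, 1 and 2 of `A`.
  _∙_ : Fin q → Fin q → Fin q
  x ∙ y = A.entry (proj₁ (meet x y)) (suc (suc zero))

  ∙-cancelˡ : ∀ {x x′ y y′} → x ≡ x′ → x ∙ y ≡ x′ ∙ y′ → y ≡ y′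
  ∙-cancelˡ {x} {_} {y} {y′} refl eq = trans (sym (meet₁ x y)) (trans
    (cong (λ r → A.entry r (suc zero)) (A.injective {zero} (λ ()) (trans (meet₀ x y) (sym (meet₀ x y′))) eq))
    (meet₁ x y′))

  ∙-cancelʳ : ∀ {x x′ y y′} → y ≡ y′ → x ∙ y ≡ x′ ∙ y′ → x ≡ x′
  ∙-cancelʳ {x} {x′} {y} refl eq = trans (sym (meet₀ x y)) (trans
    (cong (λ r → A.entry r zero) (A.injective {suc zero} (λ ()) (trans (meet₁ x y) (sym (meet₁ x′ y))) eq))
    (meet₀ x′ y))

  Pair : Set
  Pair = Fin (q ^ K) × Fin (q ^ K)

  row : Pair → Fin K → A.Row
  row (x , y) t = proj₁ (meet (finToFun x t) (finToFun y t))

  finToFun-injective : ∀ {x y : Fin (q ^ K)} → finToFun {q} {K} x ≗ finToFun y → x ≡ y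
  finToFun-injective {x} {y} eq = trans (sym (funToFin-finToFin {K} {q} x))
    (trans (funToFin-cong eq) (funToFin-finToFin {K} {q} y))
    where
    funToFin-cong : ∀ {m} {f g : Fin m → Fin q} → f ≗ g → funToFin f ≡ funToFin g
    funToFin-cong {zero}  _  = refl
    funToFin-cong {suc m} eq = cong₂ combine (eq zero) (funToFin-cong (eq ∘ suc))

  row-injective : ∀ {p p′} → row p ≗ row p′ → p ≡ p′
  row-injective {x , y} {x′ , y′} eq = cong₂ _,_
    (finToFun-injective λ t →
      trans (sym (meet₀ _ _)) (trans (cong (λ r → A.entry r _) (eq t)) (meet₀ _ (finToFun y′ t))))
    (finToFun-injective λ t →
      trans (sym (meet₁ _ _)) (trans (cong (λ r → A.entry r _) (eq t)) (meet₁ (finToFun x′ t) _)))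

  coordinate : Pair → Fin (suc (suc K)) → Fin K → Fin q
  coordinate p zero    t = A.entry (row p t) (suc t) ∙ A.entry (row p (prev t)) zero
  coordinate p (suc i) t = A.entry (row p t) i

  new-old : ∀ i {p p′} → coordinate p zero ≗ coordinate p′ zero →
            coordinate p (suc i) ≗ coordinate p′ (suc i) → p ≡ p′
  -- Column 0 is known at every coordinate, so its value at the predecessor cancels from the new
  -- column at once.
  new-old zero new old = row-injective λ t →
    A.injective {zero} {suc t} (λ ()) (old t) (∙-cancelʳ (old (prev t)) (new t))
  new-old (suc i) {p} {p′} new old = row-injective λ t → agree t (prev-induction
    (λ t → A.entry (row p t) zero ≡ A.entry (row p′ t) zero)
    (λ t eq → ∙-cancelˡ (cong (λ r → A.entry r (suc t)) (agree t eq)) (new t))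
    -- The known column `suc i` is the one that the new column uses at coordinate `i`; cancelling it
    -- there starts the walk at `prev i`.
    {prev i} (∙-cancelˡ (old i) (new i)) t)
    where
    agree : ∀ t → A.entry (row p t) zero ≡ A.entry (row p′ t) zero → row p t ≡ row p′ t
    agree t eq = A.injective {zero} {suc i} (λ ()) eq (old t)

  power : Array (4 + k) (Fin (q ^ K))
  power = arrayFromInjective (λ p i → funToFin (coordinate p i)) λ i≢j p p′ →
    inj i≢j (pointwise p) (pointwise p′)
    where
    pointwise : ∀ {f g : Fin K → Fin q} → funToFin f ≡ funToFin g → f ≗ g
    pointwise {f} {g} eq t = trans (sym (finToFun-funToFin f t))
      (trans (cong (λ x → finToFun x t) eq) (finToFun-funToFin g t))
    inj : ∀ {i j p p′} → i ≢ j → coordinate p i ≗ coordinate p′ i → coordinate p j ≗ coordinate p′ j → p ≡ p′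
    inj {zero}  {zero}  i≢j _ _ = contradiction refl i≢j
    inj {zero}  {suc j} _ = new-old j
    inj {suc i} {zero}  _ old new = new-old i new old
    inj {suc i} {suc j} i≢j p p′ = row-injective λ t →
      A.injective (i≢j ∘ cong suc) (p t) (p′ t)

open Power using (power) public

-- Every `q` is 2-rough, which starts the induction with three columns. Each further column
-- multiplies the exponent, so that `D` is (k + 1)!.
powerArray : ∀ k → ∃ λ D → NonZero D × (∀ q .{{_ : NonZero q}} → Array (3 + k) (Fin (q ^ D)))
powerArray zero    = 1 , _ , λ q → subst (Array 3 ∘ Fin) (sym (^-identityʳ q)) (cyclic 2 q 2-rough)
powerArray (suc k) with D , D≢0 , arrays ← powerArray k =
  D * (2 + k) , m*n≢0 D (2 + k) {{D≢0}} , λ q →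
  subst (Array (4 + k) ∘ Fin) (^-*-assoc q D (2 + k)) (power (arrays q))

-- Existence for all large orders

wilsonFin : ∀ {k u w m} → Array (3 + k) (Fin (u + w)) → Array (2 + k) (Fin m) → Array (2 + k) (Fin (suc m)) →
            Holey (2 + k) (Fin u ⊎ Fin ((u + w) * m)) Left
wilsonFin {u = u} {w} {m} T A B =
  relabel (λ _ → ↔-id (Fin u) ⊎-↔ ↔-sym ((+↔⊎ ×-↔ ↔-id (Fin m)) ↔-∘ *↔×))
    (λ { _ {inj₁ _} _ → tt ; _ {inj₂ _} () }) (λ { _ {inj₁ _} _ → tt ; _ {inj₂ _} () })
    (wilson (relabelArray +↔⊎ T) A (puncture B))

fillFin : ∀ {k m n} → Holey k (Fin m ⊎ Fin n) Left → Array k (Fin m) → Array k (Fin (m + n))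
fillFin A B = relabelArray (↔-sym +↔⊎) (fillArray A B)

-- Small prime factors

∣m+n∣n⇒∣m : ∀ {d m n} → d ∣ m + n → d ∣ n → d ∣ m
∣m+n∣n⇒∣m {d} {m} {n} d∣m+n = ∣m+n∣m⇒∣n (subst (d ∣_) (+-comm m n) d∣m+n)

prime∤1 : ∀ {p} → Prime p → ¬ p ∣ 1
prime∤1 p-prime p∣1 = nonTrivial⇒≢1 {{prime⇒nonTrivial p-prime}} (∣1⇒≡1 p∣1)

prime∣^⇒prime∣ : ∀ {p} h D → Prime p → p ∣ h ^ D → p ∣ h
prime∣^⇒prime∣ h zero    p-prime p∣1 = contradiction p∣1 (prime∤1 p-prime)
prime∣^⇒prime∣ h (suc D) p-prime p∣h*h^D with euclidsLemma h (h ^ D) p-prime p∣h*h^D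
... | inj₁ p∣h   = p∣h
... | inj₂ p∣h^D = prime∣^⇒prime∣ h D p-prime p∣h^D

∣⇒∣^ : ∀ {d h} D .{{_ : NonZero D}} → d ∣ h → d ∣ h ^ D
∣⇒∣^ (suc D) d∣h = ∣m⇒∣m*n _ d∣h

prime≤⇒∣! : ∀ {p K} → Prime p → p ≤ K → p ∣ K !
prime≤⇒∣! {zero}  p-prime _   = contradiction p-prime ¬prime[0]
prime≤⇒∣! {suc p} _       p≤K = ∣-trans (m∣m*n (p !)) (m≤n⇒m!∣n! p≤K)

-- If `u` has no nontrivial divisor below `K` and `K` divides `u`, then `K` is prime; so excluding
-- primes excludes every divisor in turn.
rough-from-primes : ∀ {u} K → (∀ {p} → Prime p → p < K → ¬ p ∣ u) → K Rough u
rough-from-primes zero    _      = 0-rough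
rough-from-primes (suc K) avoids = extend K (rough-from-primes K λ p-prime p<K → avoids p-prime (m<n⇒m<1+n p<K))
  λ p-prime → avoids p-prime ≤-refl
  where
  extend : ∀ {u} K → K Rough u → (Prime K → ¬ K ∣ u) → suc K Rough u
  extend zero       _     _ = 1-rough
  extend (suc zero) _     _ = 2-rough
  extend K@(2+ _)   rough K∤u = ∤⇒rough-suc (λ K∣u → K∤u (rough∧∣⇒prime rough K∣u) K∣u) rough

-- The product of the primes up to K that do not divide N.
coprimePart : ∀ N K → ∃ λ h → NonZero h × h ≤ K ! ×
              (∀ {p} → Prime p → p ∣ N → ¬ p ∣ h) × (∀ {p} → Prime p → p ≤ K → ¬ p ∣ N → p ∣ h)
coprimePart N zero = 1 , _ , ≤-refl
  , (λ p-prime _ → prime∤1 p-prime)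
  , λ { p-prime z≤n _ → contradiction p-prime ¬prime[0] }
coprimePart N (suc K) with h , h≢0 , h≤K! , avoids , divides-h ← coprimePart N K
                      with prime? (suc K) | suc K ∣? N
... | yes sK-prime | no sK∤N = suc K * h , m*n≢0 (suc K) h {{_}} {{h≢0}} , *-monoʳ-≤ (suc K) h≤K!
  , (λ p-prime p∣N p∣sK*h → [ (λ p∣sK → ∤-of p-prime p∣N p∣sK) , avoids p-prime p∣N ]′
                              (euclidsLemma (suc K) h p-prime p∣sK*h))
  , λ p-prime p≤sK p∤N → [ (λ p<sK → ∣n⇒∣m*n (suc K) (divides-h p-prime (s≤s⁻¹ p<sK) p∤N))
                         , (λ { refl → m∣m*n h }) ]′ (m≤n⇒m<n∨m≡n p≤sK)
  where
  ∤-of : ∀ {p} → Prime p → p ∣ N → ¬ p ∣ suc K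
  ∤-of p-prime p∣N p∣sK = [ (λ { refl → contradiction p-prime ¬prime[1] }) , (λ { refl → sK∤N p∣N }) ]′
    (prime⇒irreducible sK-prime p∣sK)
... | no ¬sK-prime | _ = h , h≢0 , ≤-trans h≤K! (m≤m+n _ _) , avoids
  , λ p-prime p≤sK p∤N → [ (λ p<sK → divides-h p-prime (s≤s⁻¹ p<sK) p∤N)
                         , (λ { refl → contradiction p-prime ¬sK-prime }) ]′ (m≤n⇒m<n∨m≡n p≤sK)
... | yes _ | yes sK∣N = h , h≢0 , ≤-trans h≤K! (m≤m+n _ _) , avoids
  , λ p-prime p≤sK p∤N → [ (λ p<sK → divides-h p-prime (s≤s⁻¹ p<sK) p∤N)
                         , (λ { refl → contradiction sK∣N p∤N }) ]′ (m≤n⇒m<n∨m≡n p≤sK)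

-- With `h` the coprime part, each prime up to `K` divides exactly one of N and h^D, hence not their
-- sum.
shift : ∀ N K D .{{_ : NonZero D}} → ∃ λ h → NonZero h × h ≤ K ! × (∀ {p} → Prime p → p ≤ K → ¬ p ∣ N + h ^ D)
shift N K D with h , h≢0 , h≤K! , avoids , divides-h ← coprimePart N K =
  h , h≢0 , h≤K! , λ {p} p-prime p≤K p∣N+h^D → case-∣ p-prime p≤K p∣N+h^D (p ∣? N)
  where
  case-∣ : ∀ {p} → Prime p → p ≤ K → p ∣ N + h ^ D → ¬ Dec (p ∣ N)
  case-∣ p-prime p≤K p∣N+h^D (yes p∣N) =
    avoids p-prime p∣N (prime∣^⇒prime∣ h D p-prime (∣m+n∣m⇒∣n p∣N+h^D p∣N))
  case-∣ p-prime p≤K p∣N+h^D (no p∤N) =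
    p∤N (∣m+n∣n⇒∣m p∣N+h^D (∣⇒∣^ D (divides-h p-prime p≤K p∤N)))

private
  factor : ∀ m a L → m * a + m * (a * L * m) ≡ m * a * suc (L * m)
  factor m a L = solve (m ∷ a ∷ L ∷ [])

  collect : ∀ m a u x L → m * a + (u + x * (a * L * m)) ≡ u + a * suc (L * x) * m
  collect m a u x L = solve (m ∷ a ∷ u ∷ x ∷ L ∷ [])

  expand : ∀ m a u x L → u + a * suc (L * x) * suc m ≡ u + a * suc (L * x) * m + a + a * (L * x)
  expand m a u x L = solve (m ∷ a ∷ u ∷ x ∷ L ∷ [])

-- With L = (k+2)!, m = L^D − 1 and N = m t + u: here t = h^D s with s ≡ 1 (mod L) and
-- u ≡ N + h^D modulo every prime below k+2, so h can be chosen to make u rough.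
existence : ∀ k → ∃ λ T → ∀ N → T ≤ N → Array (2 + k) (Fin N)
existence k with D , D≢0 , arrays ← powerArray k = bound , construct
  where
  instance _ = D≢0
  K = 2 + k
  L = K !
  instance
    L≢0 : NonZero L
    L≢0 = K !≢0
    L^D≢0 : NonZero (L ^ D)
    L^D≢0 = m^n≢0 L D
  m = pred (L ^ D)
  1+m≡L^D : suc m ≡ L ^ D
  1+m≡L^D = suc-pred (L ^ D)

  ∣L^D : ∀ {p} → Prime p → p ≤ K → p ∣ suc m
  ∣L^D p-prime p≤K = subst (_ ∣_) (sym 1+m≡L^D) (∣⇒∣^ D (prime≤⇒∣! p-prime p≤K))

  instance
    m≢0 : NonZero m
    m≢0 = ≢-nonZero λ m≡0 → prime∤1 prime[2] (subst (2 ∣_) (cong suc m≡0) (∣L^D prime[2] (m≤m+n 2 k)))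

  rough-m : K Rough m
  -- The small primes divide m + 1 = L^D, hence not m.
  rough-m = rough-from-primes K λ p-prime p<K p∣m →
    prime∤1 p-prime (∣m+n∣n⇒∣m {n = m} (∣L^D p-prime (<⇒≤ p<K)) p∣m)

  bound : ℕ
  -- As a ≤ m + 1, this gives m a + m c ≤ N. Then x ≥ m, and u ≤ a L m ≤ a L x ≤ t as the
  -- construction demands.
  bound = m * suc m * suc (L * m)

  construct : ∀ N → bound ≤ N → Array K (Fin N)
  construct N bound≤N with h , h≢0 , h≤L , avoids ← shift N K D =
    -- The order t is a D-th power times the rough number s, m + 1 is a D-th power, and m and u are
    -- rough.
    subst (Array K ∘ Fin) (sym N≡) (fillFin
      (wilsonFin {k} {u} {w} {m} (subst (Array (suc K) ∘ Fin) t≡ (arrays h {{h≢0}} ⊗ᶠ cyclic K s rough-s))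
        (dropColumn (cyclic K m rough-m))
        (subst (Array K ∘ Fin) (sym 1+m≡L^D) (dropColumn (arrays L))))
      (dropColumn (cyclic K u {{u≢0}} rough-u)))
    where
    a = h ^ D
    c = a * L * m
    instance
      a≢0 : NonZero a
      a≢0 = m^n≢0 h D {{h≢0}}
      aL≢0 : NonZero (a * L)
      aL≢0 = m*n≢0 a L
      c≢0 : NonZero c
      c≢0 = m*n≢0 (a * L) m
    a≤1+m : a ≤ suc m
    a≤1+m = ≤-trans (^-monoˡ-≤ D h≤L) (≤-reflexive (sym 1+m≡L^D))
    -- Setting m a aside accounts for the 1 in s = 1 + L x; dividing the rest by c = a L m then
    -- yields N = m a s + u.
    N′ = N ∸ m * a
    u = N′ % c
    x = N′ / c
    s = suc (L * x)
    t = a * s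
    m*a+m*c≤N : m * a + m * c ≤ N
    m*a+m*c≤N = begin
      m * a + m * (a * L * m)   ≡⟨ factor m a L ⟩
      m * a * suc (L * m)       ≤⟨ *-monoˡ-≤ (suc (L * m)) (*-monoʳ-≤ m a≤1+m) ⟩
      bound                     ≤⟨ bound≤N ⟩
      N                         ∎
      where open ≤-Reasoning
    m≤x : m ≤ x
    m≤x = begin
      m            ≡⟨ m*n/n≡m m c ⟨
      m * c / c    ≤⟨ /-monoˡ-≤ c (m+n≤o⇒n≤o∸m (m * a) m*a+m*c≤N) ⟩
      x            ∎
      where
      open ≤-Reasoning
      m+n≤o⇒n≤o∸m : ∀ m {n o} → m + n ≤ o → n ≤ o ∸ m
      m+n≤o⇒n≤o∸m m {n} {o} p = m+n≤o⇒m≤o∸n n (subst (_≤ o) (+-comm m n) p)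
    u≤t : u ≤ t
    u≤t = begin
      u              ≤⟨ m%n≤n N′ c ⟩
      a * L * m      ≡⟨ *-assoc a L m ⟩
      a * (L * m)    ≤⟨ *-monoʳ-≤ a (*-monoʳ-≤ L m≤x) ⟩
      a * (L * x)    ≤⟨ *-monoʳ-≤ a (n≤1+n _) ⟩
      t              ∎
      where open ≤-Reasoning
    w = t ∸ u
    t≡ : t ≡ u + w
    t≡ = sym (m+[n∸m]≡n u≤t)
    N≡u+mt : N ≡ u + t * m
    N≡u+mt = begin
      N                                ≡⟨ m+[n∸m]≡n (m+n≤o⇒m≤o (m * a) m*a+m*c≤N) ⟨
      m * a + N′                       ≡⟨ cong (m * a +_) (m≡m%n+[m/n]*n N′ c) ⟩
      m * a + (u + x * c)              ≡⟨ collect m a u x L ⟩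
      u + t * m                        ∎
      where
      open ≡-Reasoning
    N≡ : N ≡ u + (u + w) * m
    N≡ = trans N≡u+mt (cong (λ t → u + t * m) t≡)
    rough-s : K Rough s
    rough-s = rough-from-primes K λ p-prime p<K p∣s →
      prime∤1 p-prime (∣m+n∣n⇒∣m {m = 1} p∣s (∣m⇒∣m*n x (prime≤⇒∣! p-prime (<⇒≤ p<K))))
    ∤u : ∀ {p} → Prime p → p ≤ K → ¬ p ∣ u
    -- In u + t (m + 1) = N + a + a L x, the prime `p` divides m + 1 and L, which leaves u ≡ N + a.
    ∤u {p} p-prime p≤K p∣u = avoids p-prime p≤K
      (∣m+n∣n⇒∣m {m = N + a} (subst (p ∣_) regroup
        (∣m∣n⇒∣m+n p∣u (∣n⇒∣m*n t (∣L^D p-prime p≤K))))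
        (∣n⇒∣m*n a (∣m⇒∣m*n x (prime≤⇒∣! p-prime p≤K))))
      where
      regroup : u + t * suc m ≡ N + a + a * (L * x)
      regroup = trans (expand m a u x L) (cong (λ N → N + a + a * (L * x)) (sym N≡u+mt))
    rough-u : K Rough u
    rough-u = rough-from-primes K λ p-prime p<K → ∤u p-prime (<⇒≤ p<K)
    u≢0 : NonZero u
    u≢0 = ≢-nonZero λ u≡0 → ∤u prime[2] (m≤m+n 2 k) (subst (2 ∣_) (sym u≡0) (2 ∣0))

-- Large arrays with a hole of prescribed order

×↔⊎ : ∀ {m} {Y : Set} → (Fin (suc m) × Y) ↔ (Y ⊎ (Fin m × Y))
×↔⊎ {m} {Y} = mk↔ₛ′ to from (λ { (inj₁ _) → refl ; (inj₂ _) → refl }) (λ { (zero , _) → refl ; (suc _ , _) → refl })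
  where
  to : Fin (suc m) × Y → Y ⊎ (Fin m × Y)
  to (zero  , y) = inj₁ y
  to (suc x , y) = inj₂ (x , y)
  from : Y ⊎ (Fin m × Y) → Fin (suc m) × Y
  from (inj₁ y)       = zero , y
  from (inj₂ (x , y)) = suc x , y

-- The fibre of the product over the one-point hole of `puncture A` is the hole of order n.
productHole : ∀ {k m n} → Array (2 + k) (Fin (suc m)) → Array (2 + k) (Fin n) →
              Holey (2 + k) (Fin n ⊎ Fin (m * n)) Left
productHole {m = m} {n} A B = relabel
  (λ _ → (↔-id (Fin n) ⊎-↔ ↔-sym *↔×) ↔-∘ ×↔⊎)
  (λ { _ {zero , _} _ → tt ; _ {suc _ , _} () }) (λ { _ {zero , _} _ → refl ; _ {suc _ , _} () })
  (puncture A ⊗ B)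

nestHole : ∀ {k n m l} → Holey k (Fin (n + m) ⊎ Fin l) Left → Holey k (Fin n ⊎ Fin m) Left →
           Holey k (Fin n ⊎ Fin (m + l)) Left
nestHole {n = n} {m} {l} A B = relabel
  (λ _ → (↔-id (Fin n) ⊎-↔ ↔-sym +↔⊎) ↔-∘ ⊎-assoc 0ℓ (Fin n) (Fin m) (Fin l))
  (λ { _ {inj₁ (inj₁ _)} _ → tt ; _ {inj₁ (inj₂ _)} () ; _ {inj₂ _} () })
  (λ { _ {inj₁ (inj₁ _)} _ → tt ; _ {inj₁ (inj₂ _)} () ; _ {inj₂ _} () })
  (fill (relabel (λ _ → +↔⊎ ⊎-↔ ↔-id (Fin l))
                 (λ { _ {inj₁ _} _ → tt ; _ {inj₂ _} () }) (λ { _ {inj₁ _} _ → tt ; _ {inj₂ _} () }) A) B)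

private
  regroup : ∀ m r b z e → r + z ≡ suc m → b + z ≡ suc e →
            r + e * suc m ≡ m * z + b * suc m
  -- Adding `z` completes the left side to (e + 1)(m + 1) and avoids subtraction.
  regroup m r b z e r+z b+z = +-cancelʳ-≡ z _ _ (begin
    r + e * suc m + z             ≡⟨ solve (m ∷ r ∷ z ∷ e ∷ []) ⟩
    r + z + e * suc m             ≡⟨ cong (_+ e * suc m) r+z ⟩
    suc e * suc m                 ≡⟨ cong (_* suc m) b+z ⟨
    (b + z) * suc m               ≡⟨ solve (m ∷ b ∷ z ∷ []) ⟩
    m * z + b * suc m + z         ∎)
    where open ≡-Reasoning

-- N = m t + u with m = n T + 1 and u a multiple n T z of n, where z ≡ − N (mod m); the hole of size u
-- is then filled by the product of the array of order n with one of order T z.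
module _ (k n : ℕ) .{{_ : NonZero n}} (B : Array (2 + k) (Fin n))
         (T₀ : ℕ) (arrays : ∀ N → T₀ ≤ N → Array (3 + k) (Fin N)) where

  private
    T = suc T₀
    -- The inflation factor is `suc m`. Modulo it n T ≡ -1, so u = n T z ≡ -z, and z ≡ -N makes N -
    -- u divisible by it.
    m = n * T
  embeddingBound : ℕ
  -- Chosen so that t ≥ m z + T for every z ≤ m + 1.
  embeddingBound = (suc m + m * suc m + T) * suc m

  embeddingAbove : ∀ N → embeddingBound ≤ N → ∃ λ M → n + M ≡ N × Holey (2 + k) (Fin n ⊎ Fin M) Left
  embeddingAbove N bound≤N = a′ * n + (u + w) * suc m , total , nestHole
    (wilsonFin {k} {n + a′ * n} {w} {suc m} (subst (Array (3 + k) ∘ Fin) t≡u+w (arrays t T₀≤t))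
      (dropColumn (arrays (suc m) T₀≤1+m)) (dropColumn (arrays (2 + m) (m≤n⇒m≤1+n T₀≤1+m))))
    (productHole {k} {a′} (subst (Array (2 + k) ∘ Fin) a≡ (dropColumn (arrays a T₀≤a))) B)
    where
    r = N % suc m
    e = N / suc m
    -- For r = 0 this is m + 1 and not 0, which keeps the order a = T z positive and at least `T₀`.
    z = suc m ∸ r
    r+z : r + z ≡ suc m
    r+z = m+[n∸m]≡n (m%n≤n N (suc m))
    z≤ : z ≤ suc m
    z≤ = m∸n≤m (suc m) r
    a = T * z
    instance
      z≢0 : NonZero z
      z≢0 = >-nonZero (m<n⇒0<n∸m (m%n<n N (suc m)))
      a≢0 : NonZero a
      a≢0 = m*n≢0 T z
    a′ = pred a
    a≡ : a ≡ suc a′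
    a≡ = sym (suc-pred a)
    u = n + a′ * n
    u≡m*z : u ≡ m * z
    u≡m*z = begin
      suc a′ * n   ≡⟨ cong (_* n) a≡ ⟨
      T * z * n    ≡⟨ *-comm (T * z) n ⟩
      n * (T * z)  ≡⟨ *-assoc n T z ⟨
      m * z        ∎
      where open ≡-Reasoning
    z≤e : z + (m * z + T) ≤ suc e
    z≤e = begin
      z + (m * z + T)                        ≤⟨ +-mono-≤ z≤ (+-monoˡ-≤ T (*-monoʳ-≤ m z≤)) ⟩
      suc m + (m * suc m + T)                ≡⟨ +-assoc (suc m) _ T ⟨
      suc m + m * suc m + T                  ≡⟨ m*n/n≡m _ (suc m) ⟨
      embeddingBound / suc m                          ≤⟨ /-monoˡ-≤ (suc m) bound≤N ⟩
      e                                      ≤⟨ n≤1+n e ⟩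
      suc e                                  ∎
      where open ≤-Reasoning
    t = suc e ∸ z
    t+z : t + z ≡ suc e
    t+z = m∸n+n≡m (m+n≤o⇒m≤o z z≤e)
    mz+T≤t : m * z + T ≤ t
    mz+T≤t = m+n≤o⇒m≤o∸n (m * z + T) (subst (_≤ suc e) (+-comm z _) z≤e)
    u≤t : u ≤ t
    u≤t = subst (_≤ t) (sym u≡m*z) (m+n≤o⇒m≤o (m * z) mz+T≤t)
    T₀≤t : T₀ ≤ t
    T₀≤t = ≤-trans (n≤1+n T₀) (m+n≤o⇒n≤o (m * z) mz+T≤t)
    T₀≤1+m : T₀ ≤ suc m
    T₀≤1+m = m≤n⇒m≤1+n (≤-trans (n≤1+n T₀) (m≤n*m T n))
    T₀≤a : T₀ ≤ a
    T₀≤a = ≤-trans (n≤1+n T₀) (m≤m*n T z)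
    w = t ∸ u
    t≡u+w : t ≡ u + w
    t≡u+w = sym (m+[n∸m]≡n u≤t)
    total : n + (a′ * n + (u + w) * suc m) ≡ N
    total = begin
      n + (a′ * n + (u + w) * suc m)  ≡⟨ +-assoc n (a′ * n) _ ⟨
      u + (u + w) * suc m             ≡⟨ cong₂ (λ u t → u + t * suc m) u≡m*z (sym t≡u+w) ⟩
      m * z + t * suc m               ≡⟨ regroup m r t z e r+z t+z ⟨
      r + e * suc m                   ≡⟨ m≡m%n+[m/n]*n N (suc m) ⟨
      N                               ∎
      where open ≡-Reasoning

embedding : ∀ k n .{{_ : NonZero n}} → Array (2 + k) (Fin n) →
            ∃ λ N₀ → ∀ N → N₀ ≤ N → ∃ λ M → n + M ≡ N × Holey (2 + k) (Fin n ⊎ Fin M) Left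
embedding k n B = embeddingBound k n B T₀ arrays , embeddingAbove k n B T₀ arrays
  where
  -- One column more than the result has, to serve as the extra column of Wilson's construction.
  T₀ = proj₁ (existence (suc k))
  arrays = proj₂ (existence (suc k))

-- Parities of permutations

sum-zero : ∀ {n} {f : Fin n → Parity} → (∀ i → f i ≡ 0ℙ) → sum f ≡ 0ℙ
sum-zero {n} f≡0 = trans (sum-cong-≗ f≡0) (sum-replicate-zero n)

sum-single : ∀ {n} (f : Fin n → Parity) i → (∀ {j} → j ≢ i → f j ≡ 0ℙ) → sum f ≡ f i
sum-single {suc n} f i f≡0 = trans (sum-remove f)
  (trans (cong (f i ℙ.+_) (sum-zero λ j → f≡0 (punchInᵢ≢i i j))) (ℙ.+-identityʳ (f i)))

sum-split : ∀ m {n} (f : Fin (m + n) → Parity) → sum f ≡ sum (λ i → f (i ↑ˡ n)) ℙ.+ sum (λ j → f (m ↑ʳ j))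
sum-split zero    f = refl
sum-split (suc m) f = trans (cong (f zero ℙ.+_) (sum-split m (f ∘ suc))) (sym (ℙ.+-assoc (f zero) _ _))

sum-combine : ∀ m {n} (f : Fin (m * n) → Parity) → sum f ≡ ∑[ x < m ] ∑[ y < n ] f (combine x y)
sum-combine zero        f = refl
sum-combine (suc m) {n} f = trans (sum-split n f)
  (cong (sum (λ y → f (y ↑ˡ (m * n))) ℙ.+_) (sum-combine m (λ z → f (n ↑ʳ z))))

-- Modulo 2 the terms at (x, y) and (y, x) cancel.
sum-symmetric : ∀ {n} (h : Fin n → Fin n → Parity) → (∀ x → h x x ≡ 0ℙ) → (∀ x y → h x y ≡ h y x) →
                ∑[ x < n ] ∑[ y < n ] h x y ≡ 0ℙ
sum-symmetric {zero}  h diag comm = refl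
sum-symmetric {suc n} h diag comm = begin
  h zero zero ℙ.+ row ℙ.+ ∑[ x < n ] (h (suc x) zero ℙ.+ ∑[ y < n ] h (suc x) (suc y))
    ≡⟨ cong₂ (λ d s → d ℙ.+ row ℙ.+ s) (diag zero) (∑-distrib-+ (λ x → h (suc x) zero) _) ⟩
  row ℙ.+ (∑[ x < n ] h (suc x) zero ℙ.+ ∑[ x < n ] ∑[ y < n ] h (suc x) (suc y))
    ≡⟨ cong (row ℙ.+_) (cong₂ ℙ._+_ (sum-cong-≗ λ x → comm (suc x) zero)
         (sum-symmetric (λ x y → h (suc x) (suc y)) (diag ∘ suc) (λ x y → comm (suc x) (suc y)))) ⟩
  row ℙ.+ (row ℙ.+ 0ℙ)
    ≡⟨ cong (row ℙ.+_) (ℙ.+-identityʳ row) ⟩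
  row ℙ.+ row
    ≡⟨ ℙ.p+p≡0ℙ row ⟩
  0ℙ ∎
  where
  open ≡-Reasoning
  row : Parity
  row = ∑[ y < n ] h zero (suc y)

below : ∀ {n} → Fin n → Fin n → Parity
below x y = if does (x <? y) then 1ℙ else 0ℙ

module _ {n : ℕ} {x y : Fin n} where

  below-< : x <ᶠ y → below x y ≡ 1ℙ
  below-< x<y rewrite dec-true (x <? y) x<y = refl

  below-≮ : ¬ x <ᶠ y → below x y ≡ 0ℙ
  below-≮ x≮y rewrite dec-false (x <? y) x≮y = refl

below-diagonal : ∀ {n} (x : Fin n) → below x x ≡ 0ℙ
below-diagonal x = below-≮ {x = x} (<ᶠ-irrefl refl)

below-opposite : ∀ {n} {x y : Fin n} → x ≢ y → below y x ≡ below x y ⁻¹ℙ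
below-opposite {x = x} {y} x≢y with <-cmp x y
... | tri< x<y _ y≮x = trans (below-≮ y≮x) (cong _⁻¹ℙ (sym (below-< x<y)))
... | tri≈ _ x≡y _   = contradiction x≡y x≢y
... | tri> x≮y _ y<x = trans (below-< y<x) (cong _⁻¹ℙ (sym (below-≮ x≮y)))

below-asym : ∀ {n} (x y : Fin n) → below x y ℙ.* below y x ≡ 0ℙ
below-asym x y with <-cmp x y
... | tri< _ _ y≮x   = trans (cong (below x y ℙ.*_) (below-≮ y≮x)) (ℙ.*-zeroʳ _)
... | tri≈ _ refl _  = cong (ℙ._* below x x) (below-diagonal x)
... | tri> x≮y _ _   = cong (ℙ._* below y x) (below-≮ x≮y)

below-⇔ : ∀ {m n} {x y : Fin m} {x′ y′ : Fin n} → (x <ᶠ y → x′ <ᶠ y′) → (x′ <ᶠ y′ → x <ᶠ y) →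
          below x y ≡ below x′ y′
below-⇔ {x = x} {y} {x′} {y′} to from = decide (x <? y)
  where
  decide : Dec (x <ᶠ y) → below x y ≡ below x′ y′
  decide (yes x<y) = trans (below-< x<y) (sym (below-< (to x<y)))
  decide (no  x≮y) = trans (below-≮ x≮y) (sym (below-≮ (x≮y ∘ from)))

below-↑ˡ : ∀ {n} m (x y : Fin n) → below (x ↑ˡ m) (y ↑ˡ m) ≡ below x y
below-↑ˡ m x y = below-⇔ (subst₂ _<_ (toℕ-↑ˡ x m) (toℕ-↑ˡ y m))
  (subst₂ _<_ (sym (toℕ-↑ˡ x m)) (sym (toℕ-↑ˡ y m)))

↑ˡ<↑ʳ : ∀ {m n} (x : Fin m) (y : Fin n) → (x ↑ˡ n) <ᶠ (m ↑ʳ y)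
↑ˡ<↑ʳ {m} {n} x y = subst₂ _<_ (sym (toℕ-↑ˡ x n)) (sym (toℕ-↑ʳ m y)) (≤-trans (toℕ<n x) (m≤m+n m (toℕ y)))

below-combine-≢ : ∀ {m n} {x x′ : Fin m} (y y′ : Fin n) → x ≢ x′ →
                  below (combine x y) (combine x′ y′) ≡ below x x′
below-combine-≢ {x = x} {x′} y y′ x≢x′ with <-cmp x x′
... | tri< x<x′ _ _   = trans (below-< (combine-monoˡ-< y y′ x<x′)) (sym (below-< x<x′))
... | tri≈ _ x≡x′ _   = contradiction x≡x′ x≢x′
... | tri> x≮x′ _ x′<x = trans (below-≮ (<ᶠ-asym (combine-monoˡ-< y′ y x′<x))) (sym (below-≮ x≮x′))

below-combine-≡ : ∀ {m n} (x : Fin m) (y y′ : Fin n) → below (combine x y) (combine x y′) ≡ below y y′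
below-combine-≡ {n = n} x y y′ = below-⇔
  (λ lt → +-cancelˡ-< (n * toℕ x) _ _ (subst₂ _<_ (toℕ-combine x y) (toℕ-combine x y′) lt))
  (λ lt → subst₂ _<_ (sym (toℕ-combine x y)) (sym (toℕ-combine x y′)) (+-monoʳ-< (n * toℕ x) lt))

inversions : ∀ {n} → (Fin n → Fin n) → Parity
inversions {n} f = ∑[ x < n ] ∑[ y < n ] (below x y ℙ.* below (f y) (f x))

-- Writing an inversion as a product of two bits opens the sums to the ring laws of ℤ₂.
π-inversions : ∀ {n} (γ : Permutation′ n) → π γ ≡ inversions (γ ⟨$⟩ʳ_)
π-inversions γ = sum-cong-≗ λ x → sum-cong-≗ λ y →
  if-∧ (does (x <? y)) (does ((γ ⟨$⟩ʳ y) <? (γ ⟨$⟩ʳ x)))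
  where
  if-∧ : ∀ a b → (if a ∧ b then 1ℙ else 0ℙ) ≡ (if a then 1ℙ else 0ℙ) ℙ.* (if b then 1ℙ else 0ℙ)
  if-∧ true  b = refl
  if-∧ false b = refl

inversions-cong : ∀ {n} {f g : Fin n → Fin n} → f ≗ g → inversions f ≡ inversions g
inversions-cong f≗g = sum-cong-≗ λ x → sum-cong-≗ λ y → cong₂ (λ a b → below x y ℙ.* below a b) (f≗g y) (f≗g x)

π-cong : ∀ {n} {γ δ : Permutation′ n} → (γ ⟨$⟩ʳ_) ≗ (δ ⟨$⟩ʳ_) → π γ ≡ π δ
π-cong {γ = γ} {δ} γ≗δ = trans (π-inversions γ) (trans (inversions-cong γ≗δ) (sym (π-inversions δ)))

π-id : ∀ {n} {γ : Permutation′ n} → (∀ x → γ ⟨$⟩ʳ x ≡ x) → π γ ≡ 0ℙ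
π-id {n} {γ} γ≗id = trans (π-inversions γ) (trans (inversions-cong γ≗id)
  (sum-zero {n} λ x → sum-zero {n} λ y → below-asym x y))

∑∑-distrib-+ : ∀ {m n} (f g : Fin m → Fin n → Parity) →
               ∑[ x < m ] ∑[ y < n ] (f x y ℙ.+ g x y) ≡
               ∑[ x < m ] ∑[ y < n ] f x y ℙ.+ ∑[ x < m ] ∑[ y < n ] g x y
∑∑-distrib-+ f g = trans (sum-cong-≗ λ x → ∑-distrib-+ (f x) (g x)) (∑-distrib-+ (λ x → sum (f x)) _)

+≡0⇒≡ : ∀ p q → p ℙ.+ q ≡ 0ℙ → p ≡ q
+≡0⇒≡ 0ℙ 0ℙ _ = refl
+≡0⇒≡ 1ℙ 1ℙ _ = refl

-- The pairs that δ, γ and their composite invert add up to a symmetric function of the pair.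
π-∘ₚ : ∀ {n} (δ γ : Permutation′ n) → π (δ ∘ₚ γ) ≡ π δ ℙ.+ π γ
π-∘ₚ {n} δ γ = begin
  π (δ ∘ₚ γ)                            ≡⟨ π-inversions (δ ∘ₚ γ) ⟩
  inversions (g ∘ d)                    ≡⟨ +≡0⇒≡ _ _ total ⟩
  inversions d ℙ.+ ∑[ x < n ] ∑[ y < n ] after x y   ≡⟨ cong₂ ℙ._+_ (π-inversions δ) reindex ⟨
  π δ ℙ.+ π γ                           ∎
  where
  open ≡-Reasoning
  d g : Fin n → Fin n
  d = δ ⟨$⟩ʳ_
  g = γ ⟨$⟩ʳ_
  composite before after h : Fin n → Fin n → Parity
  composite x y = below x y ℙ.* below (g (d y)) (g (d x))
  before x y = below x y ℙ.* below (d y) (d x)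
  after x y = below (d x) (d y) ℙ.* below (g (d y)) (g (d x))
  h x y = composite x y ℙ.+ (before x y ℙ.+ after x y)

  reindex : π γ ≡ ∑[ x < n ] ∑[ y < n ] after x y
  reindex = trans (π-inversions γ) (trans (∑-permute (λ x → ∑[ y < n ] (below x y ℙ.* below (g y) (g x))) δ)
    (sum-cong-≗ {n} λ x → ∑-permute (λ y → below (d x) y ℙ.* below (g y) (g (d x))) δ))

  perm-≢ : ∀ (ε : Permutation′ n) {x y} → x ≢ y → ε ⟨$⟩ʳ x ≢ ε ⟨$⟩ʳ y
  perm-≢ ε x≢y eq = x≢y (trans (sym (inverseˡ ε)) (trans (cong (ε ⟨$⟩ˡ_) eq) (inverseˡ ε)))

  diagonal : ∀ x → h x x ≡ 0ℙ
  diagonal x rewrite below-diagonal x | below-diagonal (d x) = refl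

  -- The bits say whether x is below y at first, after `δ`, and after both. Either side is 1 exactly
  -- when `b` differs from both `a` and `c`, a condition invariant under complementing all three.
  swap-bits : ∀ a b c → (a ℙ.* c ⁻¹ℙ) ℙ.+ ((a ℙ.* b ⁻¹ℙ) ℙ.+ (b ℙ.* c ⁻¹ℙ)) ≡
                        (a ⁻¹ℙ ℙ.* c) ℙ.+ ((a ⁻¹ℙ ℙ.* b) ℙ.+ (b ⁻¹ℙ ℙ.* c))
  swap-bits 0ℙ 0ℙ 0ℙ = refl
  swap-bits 0ℙ 0ℙ 1ℙ = refl
  swap-bits 0ℙ 1ℙ 0ℙ = refl
  swap-bits 0ℙ 1ℙ 1ℙ = refl
  swap-bits 1ℙ 0ℙ 0ℙ = refl
  swap-bits 1ℙ 0ℙ 1ℙ = refl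
  swap-bits 1ℙ 1ℙ 0ℙ = refl
  swap-bits 1ℙ 1ℙ 1ℙ = refl

  symmetric : ∀ x y → h x y ≡ h y x
  symmetric x y with x ≟ᶠ y
  ... | yes refl = refl
  ... | no x≢y rewrite below-opposite x≢y | below-opposite (perm-≢ δ x≢y)
                     | below-opposite (perm-≢ γ (perm-≢ δ x≢y)) =
    swap-bits (below x y) (below (d x) (d y)) (below (g (d x)) (g (d y)))

  total : inversions (g ∘ d) ℙ.+ (inversions d ℙ.+ ∑[ x < n ] ∑[ y < n ] after x y) ≡ 0ℙ
  total = begin
    _                              ≡⟨ cong (inversions (g ∘ d) ℙ.+_) (∑∑-distrib-+ before after) ⟨
    _                              ≡⟨ ∑∑-distrib-+ composite (λ x y → before x y ℙ.+ after x y) ⟨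
    ∑[ x < n ] ∑[ y < n ] h x y    ≡⟨ sum-symmetric h diagonal symmetric ⟩
    0ℙ                             ∎

π-inverse : ∀ {n} {γ δ : Permutation′ n} → (∀ x → δ ⟨$⟩ʳ (γ ⟨$⟩ʳ x) ≡ x) → π γ ≡ π δ
π-inverse {γ = γ} {δ} eq = +≡0⇒≡ _ _ (trans (sym (π-∘ₚ γ δ)) (π-id {γ = γ ∘ₚ δ} eq))

fiberwise : ∀ {m n} → (Fin m → Permutation′ n) → Permutation′ (m * n)
fiberwise {m} {n} g = permutation (act (λ x → g x ⟨$⟩ʳ_)) (act (λ x → g x ⟨$⟩ˡ_))
  (act-inverse (λ x → g x ⟨$⟩ʳ_) (λ x → g x ⟨$⟩ˡ_) (λ x _ → inverseʳ (g x)))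
  (act-inverse (λ x → g x ⟨$⟩ˡ_) (λ x → g x ⟨$⟩ʳ_) (λ x _ → inverseˡ (g x)))
  where
  act : (Fin m → Fin n → Fin n) → Fin (m * n) → Fin (m * n)
  act f z = let x , y = remQuot n z in combine x (f x y)
  act-inverse : ∀ f f′ → (∀ x y → f x (f′ x y) ≡ y) → ∀ z → act f (act f′ z) ≡ z
  act-inverse f f′ inv z = let x , y = remQuot {m} n z in
    trans (cong (λ (x , y) → combine x (f x y)) (remQuot-combine {m} x (f′ x y)))
      (trans (cong (combine x) (inv x y)) (combine-remQuot {m} n z))

fiberwise-combine : ∀ {m n} (g : Fin m → Permutation′ n) x y →
                    fiberwise g ⟨$⟩ʳ combine x y ≡ combine x (g x ⟨$⟩ʳ y)
fiberwise-combine {m} g x y = cong (λ (x , y) → combine x (g x ⟨$⟩ʳ y)) (remQuot-combine {m} x y)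

inversions-combine : ∀ m {n} (f : Fin (m * n) → Fin (m * n)) → inversions f ≡
  ∑[ x < m ] ∑[ y < n ] ∑[ x′ < m ] ∑[ y′ < n ]
    (below (combine x y) (combine x′ y′) ℙ.* below (f (combine x′ y′)) (f (combine x y)))
inversions-combine m {n} f = trans (sum-combine m λ z → ∑[ z′ < m * n ] (below z z′ ℙ.* below (f z′) (f z)))
  (sum-cong-≗ {m} λ x → sum-cong-≗ {n} λ y →
    sum-combine m λ z′ → below (combine x y) z′ ℙ.* below (f z′) (f (combine x y)))

-- Pairs in different fibres keep their order, so only inversions within a fibre count.
π-fiberwise : ∀ {m n} (g : Fin m → Permutation′ n) → π (fiberwise g) ≡ ∑[ x < m ] π (g x)
π-fiberwise {m} {n} g = trans (π-inversions (fiberwise g)) (trans (inversions-combine m F)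
  (sum-cong-≗ {m} λ x → trans (sum-cong-≗ {n} λ y → trans
      (sum-single (λ x′ → ∑[ y′ < n ]
          (below (combine x y) (combine x′ y′) ℙ.* below (F (combine x′ y′)) (F (combine x y))))
        x (λ x′≢x → sum-zero {n} λ y′ → distinct x′≢x y y′))
      (sum-cong-≗ {n} λ y′ → same x y y′))
    (sym (π-inversions (g x)))))
  where
  F : Fin (m * n) → Fin (m * n)
  F = fiberwise g ⟨$⟩ʳ_
  distinct : ∀ {x x′} → x′ ≢ x → ∀ y y′ →
             below (combine x y) (combine x′ y′) ℙ.* below (F (combine x′ y′)) (F (combine x y)) ≡ 0ℙ
  distinct {x} {x′} x′≢x y y′ rewrite fiberwise-combine g x y | fiberwise-combine g x′ y′
    | below-combine-≢ y y′ (≢-sym x′≢x) | below-combine-≢ (g x′ ⟨$⟩ʳ y′) (g x ⟨$⟩ʳ y) x′≢x = below-asym x x′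
  same : ∀ x y y′ → below (combine x y) (combine x y′) ℙ.* below (F (combine x y′)) (F (combine x y)) ≡
         below y y′ ℙ.* below (g x ⟨$⟩ʳ y′) (g x ⟨$⟩ʳ y)
  same x y y′ rewrite fiberwise-combine g x y | fiberwise-combine g x y′ =
    cong₂ ℙ._*_ (below-combine-≡ x y y′) (below-combine-≡ x (g x ⟨$⟩ʳ y′) (g x ⟨$⟩ʳ y))

exchange : ∀ n → Permutation′ (n * n)
exchange n = permutation act act involutive involutive
  where
  act : Fin (n * n) → Fin (n * n)
  act z = let x , y = remQuot {n} n z in combine y x
  involutive : ∀ z → act (act z) ≡ z
  involutive z = let x , y = remQuot {n} n z in
    trans (cong (λ (x , y) → combine y x) (remQuot-combine {n} y x)) (combine-remQuot {n} n z)

exchange-combine : ∀ {n} (x y : Fin n) → exchange n ⟨$⟩ʳ combine x y ≡ combine y x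
exchange-combine {n} x y = cong (λ (x , y) → combine y x) (remQuot-combine {n} x y)

∑-below : ∀ n → ∑[ x < n ] ∑[ y < n ] below x y ≡ parity (n C 2)
∑-below zero    = refl
∑-below (suc n) = begin
  ∑[ y < n ] below zero (suc y) ℙ.+ ∑[ x < n ] ∑[ y < n ] below (suc x) (suc y)
    ≡⟨ cong₂ ℙ._+_ (trans (sum-cong-≗ {n} λ y → below-< {x = zero} {suc y} z<s) (ones n))
         (trans (sum-cong-≗ {n} λ x → sum-cong-≗ {n} λ y → below-⇔ {x = suc x} {suc y} {x} {y} s<s⁻¹ s<s)
           (∑-below n)) ⟩
  parity n ℙ.+ parity (n C 2)
    ≡⟨ ℙ.+-homo-+ n (n C 2) ⟨
  parity (n + n C 2)
    ≡⟨ cong (λ k → parity (k + n C 2)) (nC1≡n n) ⟨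
  parity (n C 1 + n C 2)
    ≡⟨ cong parity (nCk+nC[k+1]≡[n+1]C[k+1] n 1) ⟩
  parity (suc n C 2) ∎
  where
  open ≡-Reasoning
  ones : ∀ n → ∑[ y < n ] 1ℙ ≡ parity n
  ones zero    = refl
  ones (suc n) = trans (cong _⁻¹ℙ (ones n)) (trans (cong _⁻¹ℙ (sym (ℙ.suc-homo-⁻¹ n))) (ℙ.⁻¹-involutive _))

-- The pairs (x, y) and (x′, y′), in this order, are inverted exactly when x < x′ and y′ < y. This
-- gives C(n,2)² inversions, and squaring preserves parity.
π-exchange : ∀ n → π (exchange n) ≡ parity (n C 2)
π-exchange n = begin
  π (exchange n)
    ≡⟨ trans (π-inversions (exchange n)) (inversions-combine n E) ⟩
  _
    ≡⟨ (sum-cong-≗ {n} λ x → sum-cong-≗ {n} λ y → sum-cong-≗ {n} λ x′ → sum-cong-≗ {n} λ y′ → inverted x y x′ y′) ⟩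
  ∑[ x < n ] ∑[ y < n ] ∑[ x′ < n ] ∑[ y′ < n ] (below x x′ ℙ.* below y′ y)
    ≡⟨ (sum-cong-≗ {n} λ x → trans (sum-cong-≗ {n} λ y → trans
         (sum-cong-≗ {n} λ x′ → sym (*-distribˡ-sum (below x x′) (λ y′ → below y′ y)))
         (sym (*-distribʳ-sum (∑[ y′ < n ] below y′ y) (below x))))
         (sym (*-distribˡ-sum (sum (below x)) (λ y → ∑[ y′ < n ] below y′ y)))) ⟩
  ∑[ x < n ] (sum (below x) ℙ.* ∑[ y < n ] ∑[ y′ < n ] below y′ y)
    ≡⟨ *-distribʳ-sum {n} (∑[ y < n ] ∑[ y′ < n ] below y′ y) (λ x → sum (below x)) ⟨
  (∑[ x < n ] sum (below x)) ℙ.* (∑[ y < n ] ∑[ y′ < n ] below y′ y)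
    ≡⟨ cong ((∑[ x < n ] sum (below x)) ℙ.*_) (∑-comm {n} {n} (λ y y′ → below y′ y)) ⟩
  (∑[ x < n ] sum (below x)) ℙ.* (∑[ x < n ] sum (below x))
    ≡⟨ ℙ.*-idem _ ⟩
  ∑[ x < n ] sum (below x)
    ≡⟨ ∑-below n ⟩
  parity (n C 2) ∎
  where
  open ≡-Reasoning
  E : Fin (n * n) → Fin (n * n)
  E = exchange n ⟨$⟩ʳ_
  inverted : ∀ (x y x′ y′ : Fin n) →
             below (combine x y) (combine x′ y′) ℙ.* below (E (combine x′ y′)) (E (combine x y)) ≡
             below x x′ ℙ.* below y′ y
  inverted x y x′ y′ rewrite exchange-combine x y | exchange-combine x′ y′ with x ≟ᶠ x′ | y ≟ᶠ y′
  ... | yes refl | yes refl rewrite below-diagonal (combine x y) | below-diagonal x = refl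
  ... | yes refl | no y≢y′ rewrite below-combine-≡ x y y′ | below-combine-≢ x x (≢-sym y≢y′) | below-diagonal x =
    below-asym y y′
  ... | no x≢x′ | yes refl rewrite below-combine-≢ y y x≢x′ | below-combine-≡ y x′ x | below-diagonal y =
    trans (below-asym x x′) (sym (ℙ.*-zeroʳ (below x x′)))
  ... | no x≢x′ | no y≢y′ = cong₂ ℙ._*_ (below-combine-≢ y y′ x≢x′) (below-combine-≢ x′ x (≢-sym y≢y′))

-- The τ-parity

τ-plausible : ∀ {k n} (A : OA k n) → Plausible k n (τ A)
τ-plausible {k} {n} A = record
  { symmetric = symmetric
  ; additive  = λ {c} {i} {j} {ℓ} cij ciℓ cℓj → trans
      (sum-cong-≗ {n} λ s → trans (π-cong {γ = ρ A s c i j cij} {ρ A s c i ℓ ciℓ ∘ₚ ρ A s c ℓ j cℓj}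
                                     (compose cij ciℓ cℓj s))
                                  (π-∘ₚ (ρ A s c i ℓ ciℓ) (ρ A s c ℓ j cℓj)))
      (∑-distrib-+ (λ s → π (ρ A s c i ℓ ciℓ)) (λ s → π (ρ A s c ℓ j cℓj)))
  ; cyclic    = cyclicity
  }
  where
  open OA A

  symmetric : ∀ {c i j} (cij : Distinct c i j) (cji : Distinct c j i) → τ A c i j cij ≡ τ A c j i cji
  symmetric {c} {i} {j} cij cji = sum-cong-≗ {n} λ s →
    π-inverse {γ = ρ A s c i j cij} {ρ A s c j i cji} (λ x → inverseˡ (ρ A s c i j cij))

  compose : ∀ {c i j ℓ} (cij : Distinct c i j) (ciℓ : Distinct c i ℓ) (cℓj : Distinct c ℓ j) s x →
            ρ A s c i j cij ⟨$⟩ʳ x ≡ ρ A s c ℓ j cℓj ⟨$⟩ʳ (ρ A s c i ℓ ciℓ ⟨$⟩ʳ x)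
  compose {c} {i} {j} {ℓ} cij@(c≢i , _) ciℓ cℓj s x =
    -- Every `s`, `x` is read off a row, along which all three permutations can be evaluated.
    let r , (p , q) , _ = unique c≢i s x
    in subst₂ (λ s x → ρ A s c i j cij ⟨$⟩ʳ x ≡ ρ A s c ℓ j cℓj ⟨$⟩ʳ (ρ A s c i ℓ ciℓ ⟨$⟩ʳ x)) p q
         (trans (ρ-entry A _ c i j cij r refl) (sym (trans
           (cong (ρ A (entry r c) c ℓ j cℓj ⟨$⟩ʳ_) (ρ-entry A _ c i ℓ ciℓ r refl))
           (ρ-entry A _ c ℓ j cℓj r refl))))

  code : Fin (n * n) → Fin k → Fin k → Fin (n * n)
  code r c i = combine (entry r c) (entry r i)

  step : ∀ {c i j} → Distinct c i j → Permutation′ (n * n)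
  step {c} {i} {j} d = fiberwise λ s → ρ A s c i j d

  step-code : ∀ {c i j} (d : Distinct c i j) r → step d ⟨$⟩ʳ code r c i ≡ code r c j
  step-code {c} {i} {j} d r = trans (fiberwise-combine (λ s → ρ A s c i j d) (entry r c) (entry r i))
    (cong (combine (entry r c)) (ρ-entry A _ c i j d r refl))

  π-step : ∀ {c i j} (d : Distinct c i j) → π (step d) ≡ τ A c i j d
  π-step {c} {i} {j} d = π-fiberwise λ s → ρ A s c i j d

  cyclicity : ∀ {c i j} (cij : Distinct c i j) (icj : Distinct i c j) (jci : Distinct j c i) →
              τ A c i j cij ℙ.+ τ A i c j icj ℙ.+ τ A j c i jci ≡ parity (n C 2)
  cyclicity {c} {i} {j} cij@(c≢i , c≢j , i≢j) icj jci = +≡0⇒≡ _ _ (begin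
    a ℙ.+ b ℙ.+ d ℙ.+ e
      ≡⟨ ℙ.+-identityʳ _ ⟨
    a ℙ.+ b ℙ.+ d ℙ.+ e ℙ.+ 0ℙ
      -- The loop has three exchanges, so two cancelling copies of `e` are added.
      ≡⟨ cong (a ℙ.+ b ℙ.+ d ℙ.+ e ℙ.+_) (ℙ.p+p≡0ℙ e) ⟨
    a ℙ.+ b ℙ.+ d ℙ.+ e ℙ.+ (e ℙ.+ e)
      ≡⟨ solve⊕ 4 (λ a b d e → (((a ⊕ b) ⊕ d) ⊕ e) ⊕ (e ⊕ e) ⊜ a ⊕ (e ⊕ (d ⊕ (e ⊕ (b ⊕ e))))) refl a b d e ⟩
    a ℙ.+ (e ℙ.+ (d ℙ.+ (e ℙ.+ (b ℙ.+ e))))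
      ≡⟨ signs ⟨
    π loop
      ≡⟨ π-id {γ = loop} loop-id ⟩
    0ℙ ∎)
    where
    open ≡-Reasoning
    ijc : Distinct i j c
    ijc = i≢j , ≢-sym c≢i , ≢-sym c≢j
    a b d e : Parity
    a = τ A c i j cij
    b = τ A i c j icj
    d = τ A j c i jci
    e = parity (n C 2)
    E : Permutation′ (n * n)
    E = exchange n
    loop₁ loop₂ loop₃ loop₄ loop : Permutation′ (n * n)
    loop₄ = step ijc ∘ₚ E
    loop₃ = E ∘ₚ loop₄
    loop₂ = step jci ∘ₚ loop₃
    loop₁ = E ∘ₚ loop₂
    loop  = step cij ∘ₚ loop₁
    signs : π loop ≡ a ℙ.+ (e ℙ.+ (d ℙ.+ (e ℙ.+ (b ℙ.+ e))))
    signs = trans (π-∘ₚ (step cij) loop₁) (cong₂ ℙ._+_ (π-step cij)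
      (trans (π-∘ₚ E loop₂) (cong₂ ℙ._+_ (π-exchange n)
      (trans (π-∘ₚ (step jci) loop₃) (cong₂ ℙ._+_ (π-step jci)
      (trans (π-∘ₚ E loop₄) (cong₂ ℙ._+_ (π-exchange n)
      (trans (π-∘ₚ (step ijc) E) (cong₂ ℙ._+_ (trans (π-step ijc) (symmetric ijc icj)) (π-exchange n))))))))))
    loop-code : ∀ r → loop ⟨$⟩ʳ code r c i ≡ code r c i
    loop-code r = begin
      loop  ⟨$⟩ʳ code r c i   ≡⟨ cong (loop₁ ⟨$⟩ʳ_) (step-code cij r) ⟩
      loop₁ ⟨$⟩ʳ code r c j   ≡⟨ cong (loop₂ ⟨$⟩ʳ_) (exchange-combine (entry r c) (entry r j)) ⟩
      loop₂ ⟨$⟩ʳ code r j c   ≡⟨ cong (loop₃ ⟨$⟩ʳ_) (step-code jci r) ⟩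
      loop₃ ⟨$⟩ʳ code r j i   ≡⟨ cong (loop₄ ⟨$⟩ʳ_) (exchange-combine (entry r j) (entry r i)) ⟩
      loop₄ ⟨$⟩ʳ code r i j   ≡⟨ cong (E ⟨$⟩ʳ_) (step-code ijc r) ⟩
      E     ⟨$⟩ʳ code r i c   ≡⟨ exchange-combine (entry r i) (entry r c) ⟩
      code r c i              ∎
    loop-id : ∀ z → loop ⟨$⟩ʳ z ≡ z
    loop-id z = let x , y = remQuot {n} n z
                    r , (p , q) , _ = unique c≢i x y
                    z≡ = trans (cong₂ combine p q) (combine-remQuot {n} n z)
                in subst (λ z → loop ⟨$⟩ʳ z ≡ z) z≡ (loop-code r)

-- Passing between `Array` and `OA`

toOA : ∀ {k n} → Array (2 + k) (Fin n) → OA (2 + k) n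
toOA {k} {n} A = record
  { entry  = λ c → A.entry (decode c)
  ; unique = λ {i} {j} i≢j x y → let r , p , q = A.exists i≢j x y proj₁ in
      encode r , ( trans (cong (λ r → A.entry r i) (decode-encode r)) p
                 , trans (cong (λ r → A.entry r j) (decode-encode r)) q)
               , λ {c} (p′ , q′) → trans
                   (cong encode (A.injective i≢j (trans p (sym p′)) (trans q (sym q′)))) (encode-decode c)
  }
  where
  module A = Holey A
  meet : ∀ x y → ∃ λ r → A.entry r zero ≡ x × A.entry r (suc zero) ≡ y
  meet x y = A.exists {zero} {suc zero} (λ ()) x y proj₁
  decode : Fin (n * n) → A.Row
  decode c = let x , y = remQuot {n} n c in proj₁ (meet x y)
  encode : A.Row → Fin (n * n)
  encode r = combine (A.entry r zero) (A.entry r (suc zero))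
  encode-decode : ∀ c → encode (decode c) ≡ c
  encode-decode c = let x , y = remQuot {n} n c
                        _ , p , q = meet x y
                    in trans (cong₂ combine p q) (combine-remQuot {n} n c)
  decode-encode : ∀ r → decode (encode r) ≡ r
  decode-encode r =
    let x , y = remQuot {n} n (encode r)
        _ , p , q = meet x y
        x≡ , y≡ = combine-injective _ _ _ _ (combine-remQuot {n} n (encode r))
    in A.injective {zero} {suc zero} (λ ()) (trans p x≡) (trans q y≡)

toOA-row : ∀ {k n} (A : Array (2 + k) (Fin n)) (r : Holey.Row A) →
           ∃ λ c → ∀ i → OA.entry (toOA A) c i ≡ Holey.entry A r i
toOA-row A r =
  let open Holey A
      c , (p , q) , _ = OA.unique (toOA A) {zero} {suc zero} (λ ()) (entry r zero) (entry r (suc zero))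
      same = injective {zero} {suc zero} (λ ()) p q
  in c , λ i → cong (λ r → entry r i) same

fromOA : ∀ {k n} → OA k n → Array k (Fin n)
fromOA {k} {n} A = record
  { Row       = Fin (n * n)
  ; entry     = entry
  ; injective = λ {i} {j} {r} {r′} i≢j p q →
      let _ , _ , eq = unique i≢j (entry r′ i) (entry r′ j) in trans (sym (eq (p , q))) (eq (refl , refl))
  ; exists    = λ i≢j x y _ → let r , pq , _ = unique i≢j x y in r , pq
  ; sparse    = λ _ ()
  }
  where open OA A

-- Evaluates `ρ` from any suitable row of `A`, whatever number `toOA` gives to that row.
ρ-toOA : ∀ {k n} (A : Array (2 + k) (Fin n)) (r : Holey.Row A) {s x y c i j} (d : Distinct c i j) →
         Holey.entry A r c ≡ s → Holey.entry A r i ≡ x → Holey.entry A r j ≡ y →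
         ρ (toOA A) s c i j d ⟨$⟩ʳ x ≡ y
ρ-toOA A r {c = c} {i} {j} d p q o with z , row ← toOA-row A r =
  trans (cong (ρ (toOA A) _ c i j d ⟨$⟩ʳ_) (trans (sym q) (sym (row i))))
    (trans (ρ-entry (toOA A) _ c i j d z (trans (row c) p)) (trans (row j) o))

-- Exchanging a subarray

outer : ∀ n m → (Fin (n + m) → Fin (n + m)) → Parity
outer n m f = ∑[ x < m ] ∑[ y < m ] (below (n ↑ʳ x) (n ↑ʳ y) ℙ.* below (f (n ↑ʳ y)) (f (n ↑ʳ x)))

outer-cong : ∀ n m {f g : Fin (n + m) → Fin (n + m)} → (∀ y → f (n ↑ʳ y) ≡ g (n ↑ʳ y)) →
             outer n m f ≡ outer n m g
outer-cong n m eq = sum-cong-≗ {m} λ x → sum-cong-≗ {m} λ y →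
  cong₂ (λ a b → below (n ↑ʳ x) (n ↑ʳ y) ℙ.* below a b) (eq y) (eq x)

-- The permutation preserves the first n symbols, hence also the last m, so mixed pairs are never
-- inverted.
π-block : ∀ {n m} (γ : Permutation′ (n + m)) (σ : Permutation′ n) →
          (∀ x → γ ⟨$⟩ʳ (x ↑ˡ m) ≡ (σ ⟨$⟩ʳ x) ↑ˡ m) → π γ ≡ π σ ℙ.+ outer n m (γ ⟨$⟩ʳ_)
π-block {n} {m} γ σ block = begin
  π γ
    ≡⟨ π-inversions γ ⟩
  inversions g
    ≡⟨ trans (sum-split n (λ x → ∑[ y < n + m ] inv x y)) (cong₂ ℙ._+_
         (sum-cong-≗ {n} λ x → sum-split n (inv (x ↑ˡ m))) (sum-cong-≗ {m} λ x → sum-split n (inv (n ↑ʳ x)))) ⟩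
  ∑[ x < n ] (∑[ y < n ] inv (x ↑ˡ m) (y ↑ˡ m) ℙ.+ ∑[ y < m ] inv (x ↑ˡ m) (n ↑ʳ y))
    ℙ.+ ∑[ x < m ] (∑[ y < n ] inv (n ↑ʳ x) (y ↑ˡ m) ℙ.+ ∑[ y < m ] inv (n ↑ʳ x) (n ↑ʳ y))
    ≡⟨ cong₂ ℙ._+_
         (sum-cong-≗ {n} λ x → trans (cong₂ ℙ._+_ (sum-cong-≗ {n} (inner x))
                                                    (sum-zero {m} (rising x))) (ℙ.+-identityʳ _))
         (sum-cong-≗ {m} λ x → cong (ℙ._+ ∑[ y < m ] inv (n ↑ʳ x) (n ↑ʳ y)) (sum-zero {n} (falling x))) ⟩
  inversions (σ ⟨$⟩ʳ_) ℙ.+ outer n m g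
    ≡⟨ cong (ℙ._+ outer n m g) (π-inversions σ) ⟨
  π σ ℙ.+ outer n m g ∎
  where
  open ≡-Reasoning
  g : Fin (n + m) → Fin (n + m)
  g = γ ⟨$⟩ʳ_
  inv : Fin (n + m) → Fin (n + m) → Parity
  inv x y = below x y ℙ.* below (g y) (g x)
  inner : ∀ x y → inv (x ↑ˡ m) (y ↑ˡ m) ≡ below x y ℙ.* below (σ ⟨$⟩ʳ y) (σ ⟨$⟩ʳ x)
  inner x y rewrite block x | block y = cong₂ ℙ._*_ (below-↑ˡ m x y) (below-↑ˡ m (σ ⟨$⟩ʳ y) (σ ⟨$⟩ʳ x))
  falling : ∀ x y → inv (n ↑ʳ x) (y ↑ˡ m) ≡ 0ℙ
  falling x y = cong (ℙ._* below (g (y ↑ˡ m)) (g (n ↑ʳ x))) (below-≮ (<ᶠ-asym (↑ˡ<↑ʳ y x)))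
  outside : ∀ y z → ¬ g (n ↑ʳ y) ≡ z ↑ˡ m
  -- Since `σ` is onto, `z ↑ˡ m` is already the image of a symbol of the block.
  outside y z eq = <ᶠ-irrefl same (↑ˡ<↑ʳ (σ ⟨$⟩ˡ z) y)
    where
    same : (σ ⟨$⟩ˡ z) ↑ˡ m ≡ n ↑ʳ y
    same = begin
      (σ ⟨$⟩ˡ z) ↑ˡ m               ≡⟨ inverseˡ γ ⟨
      γ ⟨$⟩ˡ g ((σ ⟨$⟩ˡ z) ↑ˡ m)    ≡⟨ cong (γ ⟨$⟩ˡ_)
                                           (trans (block _) (trans (cong (_↑ˡ m) (inverseʳ σ)) (sym eq))) ⟩
      γ ⟨$⟩ˡ g (n ↑ʳ y)             ≡⟨ inverseˡ γ ⟩
      n ↑ʳ y                        ∎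
  rising : ∀ x y → inv (x ↑ˡ m) (n ↑ʳ y) ≡ 0ℙ
  rising x y with splitAt n (g (n ↑ʳ y)) in eq
  ... | inj₁ z = contradiction (sym (splitAt⁻¹-↑ˡ eq)) (outside y z)
  ... | inj₂ z = trans (cong₂ (λ a b → below (x ↑ˡ m) (n ↑ʳ y) ℙ.* below a b)
        (sym (splitAt⁻¹-↑ʳ {n} eq)) (block x))
    (trans (cong (below (x ↑ˡ m) (n ↑ʳ y) ℙ.*_) (below-≮ (<ᶠ-asym (↑ˡ<↑ʳ (σ ⟨$⟩ʳ x) z)))) (ℙ.*-zeroʳ _))

module Plug {k n m : ℕ} (I : Holey (2 + k) (Fin n ⊎ Fin m) Left) where
  private
    module I = Holey I

  plug : OA (2 + k) n → OA (2 + k) (n + m)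
  plug B = toOA (fillFin I (fromOA B))

  ρ-inside : ∀ B s {c i j} (d : Distinct c i j) x →
             ρ (plug B) (s ↑ˡ m) c i j d ⟨$⟩ʳ (x ↑ˡ m) ≡ (ρ B s c i j d ⟨$⟩ʳ x) ↑ˡ m
  ρ-inside B s {c} {i} {j} d@(c≢i , _) x =
    let r , (p , q) , _ = OA.unique B c≢i s x
    in ρ-toOA (fillFin I (fromOA B)) (inj₂ r) d (cong (_↑ˡ m) p) (cong (_↑ˡ m) q)
         (cong (_↑ˡ m) (trans (sym (ρ-entry B s c i j d r p)) (cong (ρ B s c i j d ⟨$⟩ʳ_) q)))

  -- A pair outside the hole lies in a row of `I`, which is present whatever fills the hole.
  ρ-outside : ∀ B B′ s {c i j} (d : Distinct c i j) x → ¬ (Left (splitAt n s) × Left (splitAt n x)) →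
              ρ (plug B) s c i j d ⟨$⟩ʳ x ≡ ρ (plug B′) s c i j d ⟨$⟩ʳ x
  ρ-outside B B′ s {c} {i} {j} d@(c≢i , _) x out with r , p , q ← I.exists c≢i (splitAt n s) (splitAt n x) out =
    trans (ρ-toOA (fillFin I (fromOA B)) (inj₁ r) d (at p) (at q) refl)
      (sym (ρ-toOA (fillFin I (fromOA B′)) (inj₁ r) d (at p) (at q) refl))
    where
    at : ∀ {z z′} → z ≡ splitAt n z′ → join n m z ≡ z′
    at {z′ = z′} eq = trans (cong (join n m) eq) (join-splitAt n m z′)

  -- For `s` in the hole, the inversions among the symbols outside it; for `s` outside the hole,
  -- those of the whole permutation.
  rest : OA (2 + k) n → TripleVector (2 + k)
  rest B c i j d = ∑[ s < n ] outer n m (ρ (plug B) (s ↑ˡ m) c i j d ⟨$⟩ʳ_)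
                   ℙ.+ ∑[ s < m ] π (ρ (plug B) (n ↑ʳ s) c i j d)

  right-out : ∀ z → ¬ Left (splitAt n {m} (n ↑ʳ z))
  right-out z left rewrite splitAt-↑ʳ n m z = left

  rest-constant : ∀ B B′ c i j d → rest B c i j d ≡ rest B′ c i j d
  rest-constant B B′ c i j d = cong₂ ℙ._+_
    (sum-cong-≗ {n} λ s → outer-cong n m {ρ (plug B) (s ↑ˡ m) c i j d ⟨$⟩ʳ_} {ρ (plug B′) (s ↑ˡ m) c i j d ⟨$⟩ʳ_}
      λ y → ρ-outside B B′ (s ↑ˡ m) d (n ↑ʳ y) (λ (_ , l) → right-out y l))
    (sum-cong-≗ {m} λ s → π-cong {γ = ρ (plug B) (n ↑ʳ s) c i j d} {ρ (plug B′) (n ↑ʳ s) c i j d}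
      λ x → ρ-outside B B′ (n ↑ʳ s) d x (λ (l , _) → right-out s l))

  τ-plug : ∀ B c i j d → τ (plug B) c i j d ≡ τ B c i j d ℙ.+ rest B c i j d
  τ-plug B c i j d = begin
    τ (plug B) c i j d
      ≡⟨ sum-split n (λ s → π (ρ (plug B) s c i j d)) ⟩
    ∑[ s < n ] π (ρ (plug B) (s ↑ˡ m) c i j d) ℙ.+ late
      ≡⟨ cong (ℙ._+ late) (trans
           (sum-cong-≗ {n} λ s → π-block (ρ (plug B) (s ↑ˡ m) c i j d) (ρ B s c i j d) (ρ-inside B s d))
           (∑-distrib-+ (λ s → π (ρ B s c i j d)) (λ s → outer n m (ρ (plug B) (s ↑ˡ m) c i j d ⟨$⟩ʳ_)))) ⟩
    τ B c i j d ℙ.+ ∑[ s < n ] outer n m (ρ (plug B) (s ↑ˡ m) c i j d ⟨$⟩ʳ_) ℙ.+ late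
      ≡⟨ ℙ.+-assoc (τ B c i j d) _ late ⟩
    τ B c i j d ℙ.+ rest B c i j d ∎
    where
    open ≡-Reasoning
    late : Parity
    late = ∑[ s < m ] π (ρ (plug B) (n ↑ʳ s) c i j d)

-- The affine space of plausible vectors

plausible-difference : ∀ {k N n t u v} → Plausible k N t → Plausible k N u → Plausible k n v →
                       Plausible k n (λ c i j d → t c i j d ℙ.+ (u c i j d ℙ.+ v c i j d))
plausible-difference {k} {N} {n} {t} {u} {v} pt pu pv = record
  { symmetric = λ cij cji → cong₂ ℙ._+_ (T.symmetric cij cji)
      (cong₂ ℙ._+_ (U.symmetric cij cji) (V.symmetric cij cji))
  ; additive  = λ {c} {i} {j} {ℓ} cij ciℓ cℓj → trans
      (cong₂ ℙ._+_ (T.additive cij ciℓ cℓj) (cong₂ ℙ._+_ (U.additive cij ciℓ cℓj) (V.additive cij ciℓ cℓj)))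
      (solve⊕ 6 (λ t t′ u u′ v v′ → (t ⊕ t′) ⊕ ((u ⊕ u′) ⊕ (v ⊕ v′)) ⊜ (t ⊕ (u ⊕ v)) ⊕ (t′ ⊕ (u′ ⊕ v′))) refl
         (t c i ℓ ciℓ) (t c ℓ j cℓj) (u c i ℓ ciℓ) (u c ℓ j cℓj) (v c i ℓ ciℓ) (v c ℓ j cℓj))
  ; cyclic    = λ {c} {i} {j} cij icj jci → trans
      (solve⊕ 9 (λ t t′ t″ u u′ u″ v v′ v″ →
                  ((t ⊕ (u ⊕ v)) ⊕ (t′ ⊕ (u′ ⊕ v′))) ⊕ (t″ ⊕ (u″ ⊕ v″))
                  ⊜ ((t ⊕ t′) ⊕ t″) ⊕ (((u ⊕ u′) ⊕ u″) ⊕ ((v ⊕ v′) ⊕ v″))) refl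
         (t c i j cij) (t i c j icj) (t j c i jci) (u c i j cij) (u i c j icj) (u j c i jci)
         (v c i j cij) (v i c j icj) (v j c i jci))
      (trans (cong₂ ℙ._+_ (T.cyclic cij icj jci) (cong₂ ℙ._+_ (U.cyclic cij icj jci) (V.cyclic cij icj jci)))
      (trans (sym (ℙ.+-assoc (parity (N C 2)) (parity (N C 2)) (parity (n C 2))))
             (cong (ℙ._+ parity (n C 2)) (ℙ.p+p≡0ℙ (parity (N C 2))))))
  }
  where
  module T = Plausible pt
  module U = Plausible pu
  module V = Plausible pv

-- The second factor is 1 exactly when `c` lies between `i` and `j`, which happens for one of any
-- three distinct columns. This plausible vector lets the hypothesis supply a first array of order
-- n.
tournament : ∀ k n → TripleVector k
tournament k n c i j _ = parity (n C 2) ℙ.* (below c i ℙ.+ below c j)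

tournament-plausible : ∀ k n → Plausible k n (tournament k n)
tournament-plausible k n = record
  { symmetric = λ {c} {i} {j} _ _ → cong (parity (n C 2) ℙ.*_) (ℙ.+-comm (below c i) (below c j))
  ; additive  = λ {c} {i} {j} {ℓ} _ _ _ → trans
      (cong (parity (n C 2) ℙ.*_) (through (below c i) (below c j) (below c ℓ)))
      (ℙ.*-distribˡ-+ (parity (n C 2)) (below c i ℙ.+ below c ℓ) (below c ℓ ℙ.+ below c j))
  ; cyclic    = cyclicity
  }
  where
  through : ∀ a b c → a ℙ.+ b ≡ a ℙ.+ c ℙ.+ (c ℙ.+ b)
  through a b c = sym (trans (solve⊕ 3 (λ a b c → (a ⊕ c) ⊕ (c ⊕ b) ⊜ (a ⊕ b) ⊕ (c ⊕ c)) refl a b c)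
    (trans (cong (a ℙ.+ b ℙ.+_) (ℙ.p+p≡0ℙ c)) (ℙ.+-identityʳ _)))
  bits : ∀ p a b c → (p ℙ.* (a ℙ.+ b)) ℙ.+ (p ℙ.* (a ⁻¹ℙ ℙ.+ c)) ℙ.+ (p ℙ.* (b ⁻¹ℙ ℙ.+ c ⁻¹ℙ)) ≡ p
  bits 0ℙ _  _  _  = refl
  bits 1ℙ 0ℙ 0ℙ 0ℙ = refl
  bits 1ℙ 0ℙ 0ℙ 1ℙ = refl
  bits 1ℙ 0ℙ 1ℙ 0ℙ = refl
  bits 1ℙ 0ℙ 1ℙ 1ℙ = refl
  bits 1ℙ 1ℙ 0ℙ 0ℙ = refl
  bits 1ℙ 1ℙ 0ℙ 1ℙ = refl
  bits 1ℙ 1ℙ 1ℙ 0ℙ = refl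
  bits 1ℙ 1ℙ 1ℙ 1ℙ = refl
  cyclicity : ∀ {c i j} (cij : Distinct c i j) (icj : Distinct i c j) (jci : Distinct j c i) →
              tournament k n c i j cij ℙ.+ tournament k n i c j icj ℙ.+ tournament k n j c i jci ≡ parity (n C 2)
  cyclicity {c} {i} {j} (c≢i , c≢j , i≢j) _ _
    rewrite below-opposite c≢i | below-opposite c≢j | below-opposite i≢j =
    bits (parity (n C 2)) (below c i) (below c j) (below i j)

actual-above : ∀ {k n N} → (∀ t → Plausible (2 + k) n t → Actual (2 + k) n t) → OA (2 + k) n →
               (∃ λ M → n + M ≡ N × Holey (2 + k) (Fin n ⊎ Fin M) Left) →
               ∀ t → Plausible (2 + k) N t → Actual (2 + k) N t
actual-above {k} {n} actual B₀ (M , refl , I) t t-plausible =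
  -- The vector requested of `B` is `t` plus `rest B₀`; expressing `rest B₀` as a sum of two
  -- τ-parities is what shows it plausible.
  let B , τB≡ = actual _ (plausible-difference t-plausible (τ-plausible (plug B₀)) (τ-plausible B₀))
  in plug B , λ c i j d → begin
    τ (plug B) c i j d
      ≡⟨ τ-plug B c i j d ⟩
    τ B c i j d ℙ.+ rest B c i j d
      ≡⟨ cong₂ ℙ._+_ (trans (τB≡ c i j d) (cong (λ u → t c i j d ℙ.+ (u ℙ.+ τ B₀ c i j d)) (τ-plug B₀ c i j d)))
           (rest-constant B B₀ c i j d) ⟩
    t c i j d ℙ.+ (τ B₀ c i j d ℙ.+ rest B₀ c i j d ℙ.+ τ B₀ c i j d) ℙ.+ rest B₀ c i j d
      ≡⟨ cancel (t c i j d) (τ B₀ c i j d) (rest B₀ c i j d) ⟩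
    t c i j d ∎
  where
  open ≡-Reasoning
  open Plug I
  cancel : ∀ a b r → a ℙ.+ (b ℙ.+ r ℙ.+ b) ℙ.+ r ≡ a
  cancel a b r = trans (solve⊕ 3 (λ a b r → (a ⊕ ((b ⊕ r) ⊕ b)) ⊕ r ⊜ a ⊕ ((b ⊕ r) ⊕ (b ⊕ r))) refl a b r)
    (trans (cong (a ℙ.+_) (ℙ.p+p≡0ℙ (b ℙ.+ r))) (ℙ.+-identityʳ a))

corollary4p8 : (k n : ℕ) → 2 ≤ n → 3 ≤ k → k ≤ n + 1 →
    (∀ t → Plausible k n t → Actual k n t) →
    ∃ λ N₀ → ∀ N → N₀ ≤ N → ∀ t → Plausible k N t → Actual k N t
corollary4p8 (suc (suc k)) n 2≤n (s≤s (s≤s _)) _ actual =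
  proj₁ embedded , λ N N₀≤N → actual-above actual B₀ (proj₂ embedded N N₀≤N)
  where
  B₀ : OA (2 + k) n
  B₀ = proj₁ (actual (tournament (2 + k) n) (tournament-plausible (2 + k) n))
  embedded : ∃ λ N₀ → ∀ N → N₀ ≤ N → ∃ λ M → n + M ≡ N × Holey (2 + k) (Fin n ⊎ Fin M) Left
  embedded = embedding k n {{>-nonZero (≤-trans (s≤s z≤n) 2≤n)}} (fromOA B₀)
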